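{- There exists a test which, given parameters $\delta\in(0,1)$ and $\epsilon>0$ and sample access to two distributions $\mathbf{p}$ and $\mathbf{q}$ over a set of $n$ elements, has running time $O(\epsilon^{ -4}\log(1/\delta))$ (with no dependence on $n$) and satisfies: (1) if $\|\mathbf{p}-\mathbf{q}\|_2\le\epsilon/2$, then the test accepts with probability at least $1-\delta$; (2) if $\|\mathbf{p}-\mathbf{q}\|_2>\epsilon$, then the test rejects with probability at least $1-\delta$.
   Context: A distribution over $n$ elements (labelled by $[n]=\{1,\dots,n\}$) is a vector $\mathbf{p}=(p_1,\dots,p_n)$ with $p_i$ the probability of outputting $i$; $\|\mathbf{v}\|_2=\sqrt{\sum_i v_i^2}$. A test is a randomized algorithm that outputs accept or reject. Its only access to $\mathbf{p}$ and $\mathbf{q}$ is through black boxes: each query to a black box returns (at unit cost) an independent sample from the corresponding distribution. Elements of $[n]$ can be stored and used as array indices at unit cost. The constants hidden in $O(\cdot)$ are absolute.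
   Formalization: The running time is bounded by an absolute constant times 1 + ε⁻⁴ log(1/δ); without the added 1 the bound would tend to zero as δ → 1 or ε → ∞, although any test takes at least one step. -}

module Defs where

open import Level using (0ℓ)
open import Algebra.Bundles using (CommutativeRing; Semiring)
open import Data.Bool.Base using (Bool; true; false; if_then_else_)
open import Data.Fin.Base using (Fin; toℕ)
open import Data.List.Base using (List; []; _∷_)
open import Data.Nat.Base as ℕ using (ℕ; zero; suc)
import Data.Nat.Properties as ℕₚ
open import Data.Product.Base using (_×_; _,_; ∃; ∃-syntax)
open import Data.Unit.Base using (⊤)
open import Data.Empty using (⊥)
open import Data.Vec.Functional using (Vector; zipWith)
open import Relation.Binary.Core using (Rel)
open import Relation.Binary.Structures using (IsDecTotalOrder)
open import Relation.Nullary.Decidable using (⌊_⌋)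
open import Relation.Nullary.Negation using (¬_)
open import Relation.Unary using (Pred)
import Algebra.Definitions.RawSemiring as RawSemiringOps
import Relation.Binary.Construct.NonStrictToStrict as ToStrict

-- The classical real numbers, given axiomatically as a complete ordered field
-- (hence determined up to isomorphism).  The functions _⁻¹ and sup are total,
-- but nothing is assumed about the inverse of 0, nor about the supremum of an
-- empty or unbounded set.

record RealNumbers : Set₁ where
  field
    commutativeRing : CommutativeRing 0ℓ 0ℓ

  open CommutativeRing commutativeRing public
    using (Carrier; _≈_; _+_; _*_; -_; _-_; 0#; 1#)

  infix 4 _≤_
  field
    _≤_             : Rel Carrier 0ℓ
    isDecTotalOrder : IsDecTotalOrder _≈_ _≤_

  open IsDecTotalOrder isDecTotalOrder public using (_≤?_)
  open ToStrict _≈_ _≤_ public using (_<_)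

  infix 8 _⁻¹
  field
    0≉1         : ¬ (0# ≈ 1#)
    +-monoˡ-≤   : ∀ x {y z} → y ≤ z → y + x ≤ z + x
    *-nonneg    : ∀ {x y} → 0# ≤ x → 0# ≤ y → 0# ≤ x * y
    _⁻¹         : Carrier → Carrier
    *-inverseʳ  : ∀ x → ¬ (x ≈ 0#) → x * x ⁻¹ ≈ 1#

  IsUpperBound : Pred Carrier 0ℓ → Pred Carrier 0ℓ
  IsUpperBound P u = ∀ x → P x → x ≤ u

  -- Leastness is stated in the (classically equivalent) form that everything
  -- below the supremum is exceeded by a member of the set.
  field
    sup       : Pred Carrier 0ℓ → Carrier
    sup-upper : ∀ P → ∃ P → ∃ (IsUpperBound P) → IsUpperBound P (sup P)
    sup-least : ∀ P → ∃ P → ∃ (IsUpperBound P) →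
                ∀ z → z < sup P → ∃[ x ] (P x × z < x)

  open RawSemiringOps (Semiring.rawSemiring (CommutativeRing.semiring commutativeRing)) public
    using (_^_; sum) renaming (_×_ to _·_)

  fromℕ : ℕ → Carrier
  fromℕ k = k · 1#

  infixl 7 _/_
  _/_ : Carrier → Carrier → Carrier
  x / y = x * y ⁻¹

  -- Used for x ≥ 0 only.
  sqrt : Carrier → Carrier
  sqrt x = sup λ y → y * y ≤ x

  -- For x > 0: the supremum of the rationals r = (a - c) / b, b ≥ 1, with
  -- 2^r ≤ x.
  log₂ : Carrier → Carrier
  log₂ x = sup λ r → ∃[ a ] ∃[ c ] ∃[ b ]
    (r * fromℕ (suc b) + fromℕ c ≈ fromℕ a ×
     fromℕ 2 ^ a ≤ fromℕ 2 ^ c * x ^ suc b)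

  ‖_‖₂ : ∀ {n} → Vector Carrier n → Carrier
  ‖ v ‖₂ = sqrt (sum λ i → v i ^ 2)

  infixl 6 _⊝_
  _⊝_ : ∀ {n} → Vector Carrier n → Vector Carrier n → Vector Carrier n
  _⊝_ = zipWith _-_

  record Distribution (n : ℕ) : Set where
    field
      prob        : Vector Carrier n
      nonneg      : ∀ i → 0# ≤ prob i
      normalised  : sum prob ≈ 1#

  open Distribution public

-- Randomised algorithms are programs for a real RAM.  The machine has natural
-- number variables, arrays of naturals indexed by naturals, and real variables,
-- each named by a natural number.  Naturals can be added, truncatedly
-- subtracted and compared; reals can be added, subtracted, multiplied and
-- compared.  There is no conversion from reals to naturals, and no
-- multiplication of naturals (at unit cost it would be unrealistically strong).

infixl 6 _⊕_ _⊖_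
data NatExp : Set where
  lit     : ℕ → NatExp
  nvar    : ℕ → NatExp
  read    : (array : ℕ) (index : NatExp) → NatExp
  _⊕_ _⊖_ : NatExp → NatExp → NatExp

infixl 6 _⊞_ _⊟_
infixl 7 _⊠_
data RealExp : Set where
  real        : NatExp → RealExp
  rvar        : ℕ → RealExp
  _⊞_ _⊟_ _⊠_ : RealExp → RealExp → RealExp

infix 4 _≤ₙ_ _≤ᵣ_
data Condition : Set where
  _≤ₙ_ : NatExp → NatExp → Condition
  _≤ᵣ_ : RealExp → RealExp → Condition

data BlackBox : Set where
  𝐩 𝐪 : BlackBox

infixr 3 _⨾_
infix  5 _≔ₙ_ _≔ᵣ_
data Command : Set where
  skip      : Command
  _≔ₙ_      : ℕ → NatExp → Command
  _≔ᵣ_      : ℕ → RealExp → Command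
  write     : (array : ℕ) (index value : NatExp) → Command
  sample    : BlackBox → (target : ℕ) → Command
  flip      : (target : ℕ) → Command
  _⨾_       : Command → Command → Command
  branch    : Condition → Command → Command → Command
  while     : Condition → Command → Command

-- When the body has terminated, the test accepts if the final condition holds
-- and rejects otherwise.
record Test : Set where
  field
    body     : Command
    accepts? : Condition

infixl 5 _[_↦_]
_[_↦_] : ∀ {A : Set} → (ℕ → A) → ℕ → A → (ℕ → A)
(f [ k ↦ v ]) j = if ⌊ j ℕₚ.≟ k ⌋ then v else f j

module Execution (ℝ : RealNumbers) where
  open RealNumbers ℝ

  record Store : Set where
    field
      nats   : ℕ → ℕ
      arrays : ℕ → ℕ → ℕ
      reals  : ℕ → Carrier
  open Store public

  -- The inputs δ and ε are the initial values of real variables 0 and 1; all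
  -- other memory is initially zero.
  initial : (δ ε : Carrier) → Store
  initial δ ε = record
    { nats   = λ _ → 0
    ; arrays = λ _ _ → 0
    ; reals  = (λ _ → 0#) [ 0 ↦ δ ] [ 1 ↦ ε ]
    }

  evalₙ : NatExp → Store → ℕ
  evalₙ (lit k)    σ = k
  evalₙ (nvar x)   σ = nats σ x
  evalₙ (read a e) σ = arrays σ a (evalₙ e σ)
  evalₙ (e ⊕ f)    σ = evalₙ e σ ℕ.+ evalₙ f σ
  evalₙ (e ⊖ f)    σ = evalₙ e σ ℕ.∸ evalₙ f σ

  evalᵣ : RealExp → Store → Carrier
  evalᵣ (real e)  σ = fromℕ (evalₙ e σ)
  evalᵣ (rvar x)  σ = reals σ x
  evalᵣ (e ⊞ f)   σ = evalᵣ e σ + evalᵣ f σ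
  evalᵣ (e ⊟ f)   σ = evalᵣ e σ - evalᵣ f σ
  evalᵣ (e ⊠ f)   σ = evalᵣ e σ * evalᵣ f σ

  holds : Condition → Store → Bool
  holds (e ≤ₙ f) σ = ⌊ evalₙ e σ ℕₚ.≤? evalₙ f σ ⌋
  holds (e ≤ᵣ f) σ = ⌊ evalᵣ e σ ≤? evalᵣ f σ ⌋

  setₙ : ℕ → ℕ → Store → Store
  setₙ x k σ = record σ { nats = nats σ [ x ↦ k ] }

  setᵣ : ℕ → Carrier → Store → Store
  setᵣ x r σ = record σ { reals = reals σ [ x ↦ r ] }

  setₐ : (array index value : ℕ) → Store → Store
  setₐ a i k σ = record σ { arrays = arrays σ [ a ↦ arrays σ a [ i ↦ k ] ] }

  -- The commands still to be executed, and the current memory.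
  Configuration : Set
  Configuration = List Command × Store

  data Next (n : ℕ) : Set where
    det  : Configuration → Next n
    draw : BlackBox → (Fin n → Configuration) → Next n
    coin : (Bool → Configuration) → Next n

  -- One step has unit cost.  It evaluates at most two expressions of the
  -- program text, so for a fixed program it takes a constant number of
  -- elementary operations.
  step : ∀ {n} → Command → List Command → Store → Next n
  step skip           k σ = det (k , σ)
  step (x ≔ₙ e)       k σ = det (k , setₙ x (evalₙ e σ) σ)
  step (x ≔ᵣ e)       k σ = det (k , setᵣ x (evalᵣ e σ) σ)
  step (write a e f)  k σ = det (k , setₐ a (evalₙ e σ) (evalₙ f σ) σ)
  step (sample b x)   k σ = draw b λ i → k , setₙ x (toℕ i) σ
  step (flip x)       k σ = coin λ c → k , setₙ x (if c then 1 else 0) σ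
  step (c ⨾ d)        k σ = det (c ∷ d ∷ k , σ)
  step (branch b c d) k σ = det ((if holds b σ then c else d) ∷ k , σ)
  step (while b c)    k σ =
    det ((if holds b σ then c ∷ while b c ∷ k else k) , σ)

  start : Test → (δ ε : Carrier) → Configuration
  start T δ ε = Test.body T ∷ [] , initial δ ε

  -- HaltsWithin n t c: from c, the execution halts after at most t steps
  -- whatever the answers of the black boxes over n elements and of the coin.
  module _ (n : ℕ) where
    mutual
      HaltsWithin : ℕ → Configuration → Set
      HaltsWithin t       ([]    , σ) = ⊤
      HaltsWithin zero    (c ∷ k , σ) = ⊥
      HaltsWithin (suc t) (c ∷ k , σ) = HaltsNext t (step c k σ)

      HaltsNext : ℕ → Next n → Set
      HaltsNext t (det c)    = HaltsWithin t c
      HaltsNext t (draw b f) = ∀ i → HaltsWithin t (f i)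
      HaltsNext t (coin f)   = ∀ b → HaltsWithin t (f b)

  module _ (T : Test) {n : ℕ} (p q : Distribution n) where
    box : BlackBox → Distribution n
    box 𝐩 = p
    box 𝐪 = q

    -- The probability that, from the given configuration, the execution halts
    -- within t steps with the given verdict (true for acceptance).
    mutual
      outcome : Bool → ℕ → Configuration → Carrier
      outcome v t       ([]    , σ) = verdict v (holds (Test.accepts? T) σ)
      outcome v zero    (c ∷ k , σ) = 0#
      outcome v (suc t) (c ∷ k , σ) = expected v t (step c k σ)

      expected : Bool → ℕ → Next n → Carrier
      expected v t (det c)    = outcome v t c
      expected v t (draw b f) = sum λ i → prob (box b) i * outcome v t (f i)
      expected v t (coin f)   =
        (outcome v t (f true) + outcome v t (f false)) / fromℕ 2

      verdict : Bool → Bool → Carrier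
      verdict true  true  = 1#
      verdict false false = 1#
      verdict _     _     = 0#

  Pr-accepts Pr-rejects : Test → (δ ε : Carrier) (t : ℕ) →
                          ∀ {n} (p q : Distribution n) → Carrier
  Pr-accepts T δ ε t p q = outcome T p q true  t (start T δ ε)
  Pr-rejects T δ ε t p q = outcome T p q false t (start T δ ε)

{-# OPTIONS --safe #-}
module Submission where

open import Defs
open import Algebra.Bundles using (CommutativeRing)
open import Algebra.Solver.Ring.AlmostCommutativeRing
  using (fromCommutativeRing; _-Raw-AlmostCommutative⟶_)
open import Data.Bool.Base using (Bool; true; false; if_then_else_)
open import Data.Fin.Base using (Fin; zero; suc; toℕ)
open import Data.Integer.Base as ℤ using (ℤ; +_; -[1+_])
import Data.Integer.Properties as ℤₚ
open import Data.List.Base using ([]; _∷_)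
open import Data.Maybe.Base using (Maybe; just; nothing)
open import Data.Nat.Base as ℕ using (ℕ; zero; suc; z≤n; s≤s)
import Data.Nat.Properties as ℕₚ
open import Data.Product.Base using (Σ-syntax; ∃; ∃-syntax; _×_; _,_; proj₁; proj₂)
open import Data.Sum.Base using (_⊎_; inj₁; inj₂)
open import Data.Unit.Base using (tt)
open import Relation.Binary.Bundles using (Poset)
open import Relation.Binary.PropositionalEquality.Core as ≡ using (_≡_)
open import Relation.Binary.Structures using (IsDecTotalOrder)
open import Relation.Nullary.Decidable using (Dec; yes; no; ⌊_⌋; isYes≗does; dec-true; dec-false)
open import Relation.Nullary.Negation using (¬_; contradiction)
import Algebra.Properties.Ring as RingProperties
import Algebra.Properties.Semiring.Exp as Exp
import Algebra.Properties.Semiring.Mult as Mult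
import Algebra.Properties.Semiring.Sum as Sum
import Algebra.Solver.Ring as RingSolver
import Relation.Binary.Construct.NonStrictToStrict as ToStrict
import Relation.Binary.Reasoning.PartialOrder as PartialOrderReasoning

-- Write x = ε² and s = ‖p - q‖².  If i, j are drawn from p and k, l from q,
-- then the statistic
--
--   z = ([i = j] - [i = k]) + ([k = l] - [j = l])
--
-- lies between -2 and 2 and has mean ⟨p,p⟩ - ⟨p,q⟩ + ⟨q,q⟩ - ⟨p,q⟩ = s
-- (𝔼⁴-collision).  Hence y = 4z - 3x has mean at most -x if 2s ≤ x, which
-- follows from ‖p - q‖ ≤ ε / 2, and mean at least x if s ≥ x.
--
-- The tester makes N independent rounds, each computing one value of z, and
-- decides by a product instead of a sum: with a large constant m it compares
--
--   U = ∏ (m + 2xy)   with   D = m ^ N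
--
-- and accepts if U ≤ D.  Let r = m - x².  In the close case each factor has
-- mean at most r, so by Markov's inequality U > D has probability at most
-- (r / m) ^ N.  In the far case consider V = ∏ (m - 2xy + x²).  Since y is
-- bounded, the product of corresponding factors of U and V is at least m²;
-- so U V ≥ D², and U ≤ D forces V ≥ D.  The factors of V again have mean at
-- most r, and so the error probability is again at most (r / m) ^ N.  The two
-- arguments are close-potential and far-potential; loop-correct is the
-- induction over the rounds common to both.
--
-- This is a Chernoff bound without exponential function.  The program can
-- evaluate the error bound itself, and repeats while δ m ^ N ≤ r ^ N.  By
-- Bernoulli's inequality, 2 r ^ k ≤ m ^ k as soon as k x² ≥ m (halving), so
-- that the number of rounds is O(x⁻² log (1 / δ)) (few-rounds).
--
-- Two cases are treated separately.  If δ ≥ 1/2, a fair coin is good enough;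
-- otherwise log₂ (1 / δ) ≥ 1.  If x ≥ 2, the test may accept, because s ≤ 2
-- (distance²≤2) excludes the far case; otherwise x is bounded.

-- The program.

-- The constant m.  For 0 ≤ x ≤ 2 and |y| ≤ 14, the value 840 = 4 · 14 · 15
-- ensures m + 2xy ≥ 4y², which gives (m + 2xy)(m - 2xy + x²) ≥ m².
scale : ℕ
scale = 840

-- The indicator of equality: 1 if m = n, and 0 otherwise.
match : ℕ → ℕ → ℕ
match m n = 1 ℕ.∸ ((m ℕ.∸ n) ℕ.+ (n ℕ.∸ m))

matchₙ : NatExp → NatExp → NatExp
matchₙ e f = lit 1 ⊖ ((e ⊖ f) ⊕ (f ⊖ e))

-- Real variables: 0 holds δ, 1 holds ε, 2 holds U, 3 holds D, and 4 holds the
-- power of r.  Natural variables 0, 1 hold samples from p, and 2, 3 samples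
-- from q.  The expression estimate is the statistic z.
ε² estimate factor : RealExp
ε²       = rvar 1 ⊠ rvar 1
estimate = (real (matchₙ (nvar 0) (nvar 1)) ⊟ real (matchₙ (nvar 0) (nvar 2)))
         ⊞ (real (matchₙ (nvar 2) (nvar 3)) ⊟ real (matchₙ (nvar 1) (nvar 3)))
factor   = real (lit scale)
         ⊞ real (lit 2) ⊠ ε² ⊠ (real (lit 4) ⊠ estimate ⊟ real (lit 3) ⊠ ε²)

again δ-large ε-large : Condition
again   = rvar 0 ⊠ rvar 3 ≤ᵣ rvar 4
δ-large = real (lit 1) ≤ᵣ real (lit 2) ⊠ rvar 0
ε-large = real (lit 2) ≤ᵣ ε²

-- The coin is put into U while D is still 0, so that the outcome 0 accepts and
-- the outcome 1 rejects; if ε is large, U = D = 0 and the test accepts.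
round loop repetition sampling coinFlip : Command
round = sample 𝐩 0 ⨾ sample 𝐩 1 ⨾ sample 𝐪 2 ⨾ sample 𝐪 3
      ⨾ 2 ≔ᵣ rvar 2 ⊠ factor
      ⨾ 3 ≔ᵣ rvar 3 ⊠ real (lit scale)
      ⨾ 4 ≔ᵣ rvar 4 ⊠ (real (lit scale) ⊟ ε² ⊠ ε²)
loop = while again round
repetition = 2 ≔ᵣ real (lit 1) ⨾ 3 ≔ᵣ real (lit 1) ⨾ 4 ≔ᵣ real (lit 1) ⨾ loop
sampling = branch ε-large skip repetition
coinFlip = flip 0 ⨾ 2 ≔ᵣ real (nvar 0)

tester : Test
tester = record
  { body     = branch δ-large coinFlip sampling
  ; accepts? = rvar 2 ≤ᵣ rvar 3
  }

-- Ring and order arithmetic.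

module OrderedField (ℝ : RealNumbers) where
  open RealNumbers ℝ public
  open CommutativeRing commutativeRing public
    hiding (Carrier; _≈_; _+_; _*_; -_; _-_; 0#; 1#; zero; _≉_)
  open IsDecTotalOrder isDecTotalOrder public
    using (antisym; total; ≤-respˡ-≈; ≤-respʳ-≈)
    renaming (refl to ≤-refl; reflexive to ≤-reflexive; trans to ≤-trans)
  open RingProperties ring using (-‿involutive; -‿distribˡ-*; -‿distribʳ-*; -0#≈0#)
  open Mult semiring using (×-homo-+; ×1-homo-*)
  open Exp semiring public using (^-homo-*; ^-assocʳ)
  open Sum semiring public using (sum-cong-≋; sum-replicate-zero; ∑-distrib-+; *-distribˡ-sum)

  poset : Poset _ _ _
  poset = record
    { isPartialOrder = IsDecTotalOrder.isPartialOrder isDecTotalOrder }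

  module ≤-Reasoning = PartialOrderReasoning poset hiding (start)

  fromℕ-+ : ∀ m n → fromℕ (m ℕ.+ n) ≈ fromℕ m + fromℕ n
  fromℕ-+ = ×-homo-+ 1#

  fromℕ-* : ∀ m n → fromℕ (m ℕ.* n) ≈ fromℕ m * fromℕ n
  fromℕ-* = ×1-homo-*

  -- The integers in ℝ, the coefficients of the polynomial identities that are
  -- verified by normalisation below.  The clause for 1 makes the image of 1 the unit
  -- itself rather than fromℕ 1, which is 1# + 0#.
  fromℤ : ℤ → Carrier
  fromℤ (+ 1)    = 1#
  fromℤ (+ n)    = fromℕ n
  fromℤ -[1+ n ] = - fromℕ (suc n)

  fromℤ-+ⁿ : ∀ n → fromℤ (+ n) ≈ fromℕ n
  fromℤ-+ⁿ 0             = refl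
  fromℤ-+ⁿ 1             = sym (+-identityʳ 1#)
  fromℤ-+ⁿ (suc (suc n)) = refl

  fromℤ-neg : ∀ i → fromℤ (ℤ.- i) ≈ - fromℤ i
  fromℤ-neg (+ 0)           = sym -0#≈0#
  fromℤ-neg (+ 1)           = -‿cong (+-identityʳ 1#)
  fromℤ-neg (+ suc (suc n)) = refl
  fromℤ-neg -[1+ n ]        = trans (fromℤ-+ⁿ (suc n)) (sym (-‿involutive _))

  fromℤ-⊖ : ∀ m n → fromℤ (m ℤ.⊖ n) ≈ fromℕ m - fromℕ n
  fromℤ-⊖ m       zero    =
    trans (fromℤ-+ⁿ m) (sym (trans (+-congˡ -0#≈0#) (+-identityʳ _)))
  fromℤ-⊖ zero    (suc n) = sym (+-identityˡ _)
  fromℤ-⊖ (suc m) (suc n) = begin-equality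
    fromℤ (suc m ℤ.⊖ suc n)                  ≡⟨ ≡.cong fromℤ (ℤₚ.[1+m]⊖[1+n]≡m⊖n m n) ⟩
    fromℤ (m ℤ.⊖ n)                          ≈⟨ fromℤ-⊖ m n ⟩
    fromℕ m - fromℕ n                        ≈⟨ +-congʳ (+-identityʳ _) ⟨
    (fromℕ m + 0#) - fromℕ n                 ≈⟨ +-congʳ (+-congˡ (-‿inverseʳ 1#)) ⟨
    (fromℕ m + (1# - 1#)) - fromℕ n          ≈⟨ +-congʳ (+-assoc _ _ _) ⟨
    ((fromℕ m + 1#) - 1#) - fromℕ n          ≈⟨ +-congʳ (+-congʳ (+-comm _ _)) ⟩
    (fromℕ (suc m) - 1#) - fromℕ n           ≈⟨ +-assoc _ _ _ ⟩
    fromℕ (suc m) + (- 1# - fromℕ n)         ≈⟨ +-congˡ (RingProperties.-‿+-comm ring _ _) ⟩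
    fromℕ (suc m) - fromℕ (suc n)            ∎
    where open ≤-Reasoning

  fromℤ-+ : ∀ i j → fromℤ (i ℤ.+ j) ≈ fromℤ i + fromℤ j
  fromℤ-+ (+ m)    (+ n)    = trans (fromℤ-+ⁿ (m ℕ.+ n)) (trans (fromℕ-+ m n)
    (sym (+-cong (fromℤ-+ⁿ m) (fromℤ-+ⁿ n))))
  fromℤ-+ (+ m)    -[1+ n ] =
    trans (fromℤ-⊖ m (suc n)) (+-congʳ (sym (fromℤ-+ⁿ m)))
  fromℤ-+ -[1+ m ] (+ n)    = trans (fromℤ-⊖ n (suc m))
    (trans (+-comm _ _) (+-congˡ (sym (fromℤ-+ⁿ n))))
  fromℤ-+ -[1+ m ] -[1+ n ] = trans
    (-‿cong (trans (reflexive (≡.cong fromℕ (≡.sym (ℕₚ.+-suc (suc m) n))))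
                   (fromℕ-+ (suc m) (suc n))))
    (sym (RingProperties.-‿+-comm ring _ _))

  fromℤ-*ⁿ : ∀ m j → fromℤ (+ m ℤ.* j) ≈ fromℤ (+ m) * fromℤ j
  fromℤ-*ⁿ m (+ n)    = begin-equality
    fromℤ (+ m ℤ.* + n)          ≡⟨ ≡.cong fromℤ (ℤₚ.pos-* m n) ⟨
    fromℤ (+ (m ℕ.* n))          ≈⟨ fromℤ-+ⁿ (m ℕ.* n) ⟩
    fromℕ (m ℕ.* n)              ≈⟨ fromℕ-* m n ⟩
    fromℕ m * fromℕ n            ≈⟨ *-cong (fromℤ-+ⁿ m) (fromℤ-+ⁿ n) ⟨
    fromℤ (+ m) * fromℤ (+ n)    ∎
    where open ≤-Reasoning
  fromℤ-*ⁿ m -[1+ n ] = begin-equality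
    fromℤ (+ m ℤ.* -[1+ n ])           ≡⟨ ≡.cong fromℤ (ℤₚ.neg-distribʳ-* (+ m) (+ suc n)) ⟨
    fromℤ (ℤ.- (+ m ℤ.* + suc n))      ≈⟨ fromℤ-neg (+ m ℤ.* + suc n) ⟩
    - fromℤ (+ m ℤ.* + suc n)          ≈⟨ -‿cong (fromℤ-*ⁿ m (+ suc n)) ⟩
    - (fromℤ (+ m) * fromℤ (+ suc n))  ≈⟨ -‿distribʳ-* _ _ ⟩
    fromℤ (+ m) * - fromℤ (+ suc n)    ≈⟨ *-congˡ (fromℤ-neg (+ suc n)) ⟨
    fromℤ (+ m) * fromℤ -[1+ n ]       ∎
    where open ≤-Reasoning

  fromℤ-* : ∀ i j → fromℤ (i ℤ.* j) ≈ fromℤ i * fromℤ j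
  fromℤ-* (+ m)    j = fromℤ-*ⁿ m j
  fromℤ-* -[1+ m ] j = begin-equality
    fromℤ (-[1+ m ] ℤ.* j)            ≡⟨ ≡.cong fromℤ (ℤₚ.neg-distribˡ-* (+ suc m) j) ⟨
    fromℤ (ℤ.- (+ suc m ℤ.* j))       ≈⟨ fromℤ-neg (+ suc m ℤ.* j) ⟩
    - fromℤ (+ suc m ℤ.* j)           ≈⟨ -‿cong (fromℤ-*ⁿ (suc m) j) ⟩
    - (fromℤ (+ suc m) * fromℤ j)     ≈⟨ -‿distribˡ-* _ _ ⟩
    - fromℤ (+ suc m) * fromℤ j       ≈⟨ *-congʳ (fromℤ-neg (+ suc m)) ⟨
    fromℤ -[1+ m ] * fromℤ j          ∎
    where open ≤-Reasoning

  fromℤ-morphism : ℤ.+-*-rawRing -Raw-AlmostCommutative⟶ fromCommutativeRing commutativeRing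
  fromℤ-morphism = record
    { ⟦_⟧    = fromℤ
    ; +-homo = fromℤ-+
    ; *-homo = fromℤ-*
    ; -‿homo = fromℤ-neg
    ; 0-homo = refl
    ; 1-homo = refl
    }

  coefficient≟ : ∀ i j → Maybe (fromℤ i ≈ fromℤ j)
  coefficient≟ i j with i ℤₚ.≟ j
  ... | yes i≡j = just (reflexive (≡.cong fromℤ i≡j))
  ... | no  _   = nothing

  open RingSolver ℤ.+-*-rawRing (fromCommutativeRing commutativeRing)
    fromℤ-morphism coefficient≟ public
    using (Polynomial; solve; con; _:=_; _:+_; _:*_; _:-_; :-_)

  num : ∀ {k} → ℕ → Polynomial k
  num n = con (+ n)

  ≰⇒> : ∀ {x y} → ¬ x ≤ y → y < x
  ≰⇒> = ToStrict.≰⇒> _≈_ _≤_ sym ≤-reflexive total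

  ≰⇒≥ : ∀ {x y} → ¬ x ≤ y → y ≤ x
  ≰⇒≥ x≰y = proj₁ (≰⇒> x≰y)

  <⇒≱ : ∀ {x y} → x < y → ¬ y ≤ x
  <⇒≱ = ToStrict.<⇒≱ _≈_ _≤_ antisym

  -- The way to prove polynomial inequalities: exhibit the difference as a
  -- visibly nonnegative expression and verify the identity with the solver.
  ≤-by : ∀ {a b} d → 0# ≤ d → b ≈ a + d → a ≤ b
  ≤-by {a} {b} d 0≤d b≈a+d = begin
    a       ≈⟨ +-identityˡ a ⟨
    0# + a  ≤⟨ +-monoˡ-≤ a 0≤d ⟩
    d + a   ≈⟨ +-comm d a ⟩
    a + d   ≈⟨ b≈a+d ⟨
    b       ∎
    where open ≤-Reasoning

  difference-nonneg : ∀ {a b} → a ≤ b → 0# ≤ b - a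
  difference-nonneg {a} a≤b = ≤-respˡ-≈ (-‿inverseʳ a) (+-monoˡ-≤ (- a) a≤b)

  +-mono-≤ : ∀ {a b c d} → a ≤ b → c ≤ d → a + c ≤ b + d
  +-mono-≤ {a} {b} {c} {d} a≤b c≤d = begin
    a + c  ≤⟨ +-monoˡ-≤ c a≤b ⟩
    b + c  ≈⟨ +-comm b c ⟩
    c + b  ≤⟨ +-monoˡ-≤ b c≤d ⟩
    d + b  ≈⟨ +-comm d b ⟩
    b + d  ∎
    where open ≤-Reasoning

  +-nonneg : ∀ {x y} → 0# ≤ x → 0# ≤ y → 0# ≤ x + y
  +-nonneg 0≤x 0≤y = ≤-respˡ-≈ (+-identityʳ 0#) (+-mono-≤ 0≤x 0≤y)

  +-cancelʳ-≤ : ∀ {a b} c → a + c ≤ b + c → a ≤ b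
  +-cancelʳ-≤ {a} {b} c a+c≤b+c = ≤-by ((b + c) - (a + c))
    (difference-nonneg a+c≤b+c)
    (solve 3 (λ a b c → b := a :+ ((b :+ c) :- (a :+ c))) refl a b c)

  *-monoˡ-≤ : ∀ {a b c} → 0# ≤ c → a ≤ b → c * a ≤ c * b
  *-monoˡ-≤ {a} {b} {c} 0≤c a≤b = ≤-by (c * (b - a))
    (*-nonneg 0≤c (difference-nonneg a≤b))
    (solve 3 (λ a b c → c :* b := c :* a :+ c :* (b :- a)) refl a b c)

  *-mono-≤ : ∀ {a b c d} → 0# ≤ a → 0# ≤ d → a ≤ b → c ≤ d → a * c ≤ b * d
  *-mono-≤ {a} {b} {c} {d} 0≤a 0≤d a≤b c≤d = begin
    a * c  ≤⟨ *-monoˡ-≤ 0≤a c≤d ⟩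
    a * d  ≈⟨ *-comm a d ⟩
    d * a  ≤⟨ *-monoˡ-≤ 0≤d a≤b ⟩
    d * b  ≈⟨ *-comm d b ⟩
    b * d  ∎
    where open ≤-Reasoning

  square-nonneg : ∀ x → 0# ≤ x * x
  square-nonneg x with total 0# x
  ... | inj₁ 0≤x = *-nonneg 0≤x 0≤x
  ... | inj₂ x≤0 = ≤-respʳ-≈
    (solve 1 (λ x → (num 0 :- x) :* (num 0 :- x) := x :* x) refl x)
    (*-nonneg (difference-nonneg x≤0) (difference-nonneg x≤0))

  0≤1 : 0# ≤ 1#
  0≤1 = ≤-respʳ-≈ (*-identityˡ 1#) (square-nonneg 1#)

  0<1 : 0# < 1#
  0<1 = 0≤1 , 0≉1

  fromℕ-nonneg : ∀ n → 0# ≤ fromℕ n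
  fromℕ-nonneg zero    = ≤-refl
  fromℕ-nonneg (suc n) = +-nonneg 0≤1 (fromℕ-nonneg n)

  fromℕ-mono : ∀ {m n} → m ℕ.≤ n → fromℕ m ≤ fromℕ n
  fromℕ-mono {n = n} z≤n     = fromℕ-nonneg n
  fromℕ-mono (s≤s m≤n) = +-mono-≤ ≤-refl (fromℕ-mono m≤n)

  1≤fromℕ : ∀ n → 1# ≤ fromℕ (suc n)
  1≤fromℕ n = ≤-by (fromℕ n) (fromℕ-nonneg n) refl

  <-≤-trans : ∀ {x y z} → x < y → y ≤ z → x < z
  <-≤-trans x<y y≤z = ≰⇒> λ z≤x → <⇒≱ x<y (≤-trans y≤z z≤x)

  ≤-<-trans : ∀ {x y z} → x ≤ y → y < z → x < z
  ≤-<-trans x≤y y<z = ≰⇒> λ z≤x → <⇒≱ y<z (≤-trans z≤x x≤y)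

  fromℕ-pos : ∀ n → 0# < fromℕ (suc n)
  fromℕ-pos n = <-≤-trans 0<1 (1≤fromℕ n)

  pos⇒≉0 : ∀ {x} → 0# < x → ¬ x ≈ 0#
  pos⇒≉0 (_ , 0≉x) x≈0 = 0≉x (sym x≈0)

  *-inverseˡ : ∀ {x} → 0# < x → x ⁻¹ * x ≈ 1#
  *-inverseˡ 0<x = trans (*-comm _ _) (*-inverseʳ _ (pos⇒≉0 0<x))

  ⁻¹-nonneg : ∀ {x} → 0# < x → 0# ≤ x ⁻¹
  ⁻¹-nonneg {x} 0<x = ≤-respʳ-≈
    (trans (sym (*-assoc _ _ _)) (trans (*-congʳ (*-inverseʳ _ (pos⇒≉0 0<x))) (*-identityˡ _)))
    (*-nonneg (proj₁ 0<x) (square-nonneg (x ⁻¹)))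

  *-cancelˡ-≤ : ∀ {a b c} → 0# < c → c * a ≤ c * b → a ≤ b
  *-cancelˡ-≤ {a} {b} {c} 0<c ca≤cb = begin
    a               ≈⟨ undo a ⟨
    c ⁻¹ * (c * a)  ≤⟨ *-monoˡ-≤ (⁻¹-nonneg 0<c) ca≤cb ⟩
    c ⁻¹ * (c * b)  ≈⟨ undo b ⟩
    b               ∎
    where
    open ≤-Reasoning
    undo : ∀ x → c ⁻¹ * (c * x) ≈ x
    undo x = trans (sym (*-assoc _ _ _)) (trans (*-congʳ (*-inverseˡ 0<c)) (*-identityˡ x))

  *-pos : ∀ {x y} → 0# < x → 0# < y → 0# < x * y
  *-pos 0<x 0<y = ≰⇒>
    λ xy≤0 → <⇒≱ 0<y (*-cancelˡ-≤ 0<x (≤-respʳ-≈ (sym (zeroʳ _)) xy≤0))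

  ^-nonneg : ∀ {x} → 0# ≤ x → ∀ n → 0# ≤ x ^ n
  ^-nonneg 0≤x zero    = 0≤1
  ^-nonneg 0≤x (suc n) = *-nonneg 0≤x (^-nonneg 0≤x n)

  ^-pos : ∀ {x} → 0# < x → ∀ n → 0# < x ^ n
  ^-pos 0<x zero    = 0<1
  ^-pos 0<x (suc n) = *-pos 0<x (^-pos 0<x n)

  ^-mono-≤ : ∀ {x y} → 0# ≤ x → x ≤ y → ∀ n → x ^ n ≤ y ^ n
  ^-mono-≤ 0≤x x≤y zero    = ≤-refl
  ^-mono-≤ 0≤x x≤y (suc n) =
    *-mono-≤ 0≤x (^-nonneg (≤-trans 0≤x x≤y) n) x≤y (^-mono-≤ 0≤x x≤y n)

  ^-distrib-* : ∀ x y n → (x * y) ^ n ≈ x ^ n * y ^ n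
  ^-distrib-* x y zero    = sym (*-identityˡ 1#)
  ^-distrib-* x y (suc n) = trans (*-congˡ (^-distrib-* x y n))
    (solve 4 (λ x y a b → x :* y :* (a :* b) := x :* a :* (y :* b)) refl x y (x ^ n) (y ^ n))

  -- The Archimedean property, powers of two and logarithms.

  -- The supremum s of the multiples of x that are at most y is exceeded by
  -- x + z for every such multiple z > s - x.
  archimedes : ∀ {x y} → 0# < x → 0# ≤ y →
               ∃[ n ] (fromℕ n * x ≤ y × ¬ fromℕ (suc n) * x ≤ y)
  archimedes {x} {y} 0<x 0≤y = last-multiple (sup-least Multiple inhabited bounded (s - x) s-x<s)
    where
    Multiple : Carrier → Set
    Multiple z = ∃[ n ] (z ≈ fromℕ n * x × z ≤ y)

    inhabited : ∃ Multiple
    inhabited = 0# , 0 , sym (zeroˡ x) , 0≤y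

    bounded : ∃ (IsUpperBound Multiple)
    bounded = y , λ z z∈ → proj₂ (proj₂ z∈)

    s : Carrier
    s = sup Multiple

    s-x<s : s - x < s
    s-x<s = ≰⇒> λ s≤s-x → <⇒≱ 0<x
      (+-cancelʳ-≤ (s - x)
        (≤-respˡ-≈ (solve 2 (λ s x → s := x :+ (s :- x)) refl s x)
        (≤-respʳ-≈ (sym (+-identityˡ _)) s≤s-x)))

    last-multiple : ∃[ z ] (Multiple z × s - x < z) →
                    ∃[ n ] (fromℕ n * x ≤ y × ¬ fromℕ (suc n) * x ≤ y)
    last-multiple (z , (n , z≈nx , z≤y) , s-x<z) =
      n , ≤-respˡ-≈ z≈nx z≤y , λ next≤y → <⇒≱ s-x<z
        (+-cancelʳ-≤ x (begin
          z + x                ≈⟨ +-congʳ z≈nx ⟩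
          fromℕ n * x + x
            ≈⟨ solve 2 (λ n x → n :* x :+ x := (num 1 :+ n) :* x) refl (fromℕ n) x ⟩
          fromℕ (suc n) * x
            ≤⟨ sup-upper Multiple inhabited bounded _ (suc n , refl , next≤y) ⟩
          s                    ≈⟨ solve 2 (λ s x → s := (s :- x) :+ x) refl s x ⟩
          (s - x) + x          ∎))
      where open ≤-Reasoning

  1≤2^ : ∀ n → 1# ≤ fromℕ 2 ^ n
  1≤2^ zero    = ≤-refl
  1≤2^ (suc n) = ≤-trans (1≤2^ n) (≤-by (fromℕ 2 ^ n) (^-nonneg (fromℕ-nonneg 2) n)
    (solve 1 (λ p → num 2 :* p := p :+ p) refl (fromℕ 2 ^ n)))

  n≤2^n : ∀ n → fromℕ n ≤ fromℕ 2 ^ n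
  n≤2^n zero    = 0≤1
  n≤2^n (suc n) = begin
    1# + fromℕ n               ≤⟨ +-mono-≤ (1≤2^ n) (n≤2^n n) ⟩
    fromℕ 2 ^ n + fromℕ 2 ^ n  ≈⟨ solve 1 (λ p → p :+ p := num 2 :* p) refl (fromℕ 2 ^ n) ⟩
    fromℕ 2 * fromℕ 2 ^ n      ∎
    where open ≤-Reasoning

  2^-cancel-≤ : ∀ m n → fromℕ 2 ^ m ≤ fromℕ 2 ^ n → m ℕ.≤ n
  2^-cancel-≤ zero    n       _   = z≤n
  2^-cancel-≤ (suc m) zero    2≤1 = contradiction
    (+-cancelʳ-≤ 1# (begin
      1# + 1#                ≈⟨ solve 0 (num 1 :+ num 1 := num 2 :* num 1) refl ⟩
      fromℕ 2 * 1#           ≤⟨ *-monoˡ-≤ (fromℕ-nonneg 2) (1≤2^ m) ⟩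
      fromℕ 2 * fromℕ 2 ^ m  ≤⟨ 2≤1 ⟩
      1#                     ≈⟨ +-identityˡ 1# ⟨
      0# + 1#                ∎))
    (<⇒≱ 0<1)
    where open ≤-Reasoning
  2^-cancel-≤ (suc m) (suc n) le  =
    s≤s (2^-cancel-≤ m n (*-cancelˡ-≤ (fromℕ-pos 1) le))

  -- A decidable property that holds at 0 and fails somewhere has a last n before
  -- a failure.
  last-before : ∀ {P : ℕ → Set} → (∀ n → Dec (P n)) → P 0 →
                ∀ B → ¬ P B → ∃[ n ] (P n × ¬ P (suc n))
  last-before P? P0 zero    ¬PB = contradiction P0 ¬PB
  last-before P? P0 (suc B) ¬PB with P? B
  ... | yes PB  = B , PB , ¬PB
  ... | no  ¬P  = last-before P? P0 B ¬P

  exceeded-by-2^ : ∀ {y} → 0# ≤ y → ∃[ n ] ¬ fromℕ 2 ^ n ≤ y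
  exceeded-by-2^ {y} 0≤y =
    let n , _ , n+1≰y = archimedes 0<1 0≤y in
    suc n , λ 2^n+1≤y → n+1≰y (begin
      fromℕ (suc n) * 1#  ≈⟨ *-identityʳ _ ⟩
      fromℕ (suc n)       ≤⟨ n≤2^n (suc n) ⟩
      fromℕ 2 ^ suc n     ≤⟨ 2^n+1≤y ⟩
      y                   ∎)
    where open ≤-Reasoning

  -- Here a is one of the exponents of which log₂ y is the supremum; they are
  -- bounded by any K with y ≤ 2 ^ K.
  fromℕ≤log₂ : ∀ {y} → 1# ≤ y → ∀ a → fromℕ 2 ^ a ≤ y → fromℕ a ≤ log₂ y
  fromℕ≤log₂ {y} 1≤y a 2^a≤y =
    sup-upper _ (0# , member 0 1≤y) (fromℕ K , bound) (fromℕ a) (member a 2^a≤y)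
    where
    open ≤-Reasoning

    Exponent : Carrier → Set
    Exponent r = ∃[ a ] ∃[ c ] ∃[ b ]
      (r * fromℕ (suc b) + fromℕ c ≈ fromℕ a ×
       fromℕ 2 ^ a ≤ fromℕ 2 ^ c * y ^ suc b)

    0≤y : 0# ≤ y
    0≤y = ≤-trans 0≤1 1≤y

    K : ℕ
    K = proj₁ (exceeded-by-2^ 0≤y)

    y≤2^K : y ≤ fromℕ 2 ^ K
    y≤2^K = ≰⇒≥ (proj₂ (exceeded-by-2^ 0≤y))

    member : ∀ a → fromℕ 2 ^ a ≤ y → Exponent (fromℕ a)
    member a 2^a≤y = a , 0 , 0 ,
      solve 1 (λ r → r :* (num 1 :+ num 0) :+ num 0 := r) refl (fromℕ a) ,
      ≤-respʳ-≈ (solve 1 (λ y → y := num 1 :* (y :* num 1)) refl y) 2^a≤y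

    bound : IsUpperBound Exponent (fromℕ K)
    bound r (a , c , b , rb+c≈a , 2^a≤) = *-cancelˡ-≤ (fromℕ-pos b) (+-cancelʳ-≤ (fromℕ c) (begin
      fromℕ (suc b) * r + fromℕ c        ≈⟨ +-congʳ (*-comm _ _) ⟩
      r * fromℕ (suc b) + fromℕ c        ≈⟨ rb+c≈a ⟩
      fromℕ a                            ≤⟨ fromℕ-mono a≤ ⟩
      fromℕ (c ℕ.+ K ℕ.* suc b)          ≈⟨ trans (fromℕ-+ c _) (+-congˡ (fromℕ-* K (suc b))) ⟩
      fromℕ c + fromℕ K * fromℕ (suc b)
        ≈⟨ solve 3 (λ c k b → c :+ k :* b :=
            b :* k :+ c) refl (fromℕ c) (fromℕ K) (fromℕ (suc b)) ⟩
      fromℕ (suc b) * fromℕ K + fromℕ c  ∎))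
      where
      a≤ : a ℕ.≤ c ℕ.+ K ℕ.* suc b
      a≤ = 2^-cancel-≤ a _ (begin
        fromℕ 2 ^ a                            ≤⟨ 2^a≤ ⟩
        fromℕ 2 ^ c * y ^ suc b
          ≤⟨ *-monoˡ-≤ (^-nonneg (fromℕ-nonneg 2) c) (^-mono-≤ 0≤y y≤2^K (suc b)) ⟩
        fromℕ 2 ^ c * (fromℕ 2 ^ K) ^ suc b    ≈⟨ *-congˡ (^-assocʳ (fromℕ 2) K (suc b)) ⟩
        fromℕ 2 ^ c * fromℕ 2 ^ (K ℕ.* suc b)  ≈⟨ ^-homo-* (fromℕ 2) c (K ℕ.* suc b) ⟨
        fromℕ 2 ^ (c ℕ.+ K ℕ.* suc b)          ∎)

  -- Square roots and the Euclidean norm.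

  module _ {s : Carrier} (0≤s : 0# ≤ s) where
    private
      inhabited : ∃ λ y → y * y ≤ s
      inhabited = 0# , ≤-respˡ-≈ (sym (zeroˡ 0#)) 0≤s

      bounded : ∃ (IsUpperBound λ y → y * y ≤ s)
      bounded = s + 1# , bound
        where
        bound : IsUpperBound (λ y → y * y ≤ s) (s + 1#)
        bound y y²≤s with total 0# y
        ... | inj₁ 0≤y = ≤-by ((s - y * y) + ((y - 1#) * (y - 1#) + y))
          (+-nonneg (difference-nonneg y²≤s) (+-nonneg (square-nonneg (y - 1#)) 0≤y))
          (solve 2 (λ s y → s :+ num 1 := y :+ ((s :- y :* y) :+
             ((y :- num 1) :* (y :- num 1) :+ y))) refl s y)
        ... | inj₂ y≤0 = ≤-trans y≤0 (+-nonneg 0≤s 0≤1)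

    ≤sqrt : ∀ y → y * y ≤ s → y ≤ sqrt s
    ≤sqrt = sup-upper _ inhabited bounded

    <sqrt⇒square< : ∀ {z} → 0# ≤ z → z < sqrt s → ¬ s ≤ z * z
    <sqrt⇒square< {z} 0≤z z<√s s≤z²
      using y , y²≤s , z<y ← sup-least _ inhabited bounded z z<√s =
      <⇒≱ z<y (*-cancelˡ-≤ (≤-<-trans 0≤z z<y) (begin
        y * y  ≤⟨ ≤-trans y²≤s s≤z² ⟩
        z * z  ≤⟨ *-mono-≤ 0≤z 0≤z (proj₁ z<y) ≤-refl ⟩
        y * z  ∎))
      where open ≤-Reasoning

    -- If s > ε² / 2, then 2ε / 3 is among the numbers whose supremum is sqrt s,
    -- and 2 / 3 > 1 / 2.
    sqrt≤half⇒ : ∀ {ε} → 0# < ε → sqrt s ≤ ε / fromℕ 2 → fromℕ 2 * s ≤ ε * ε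
    sqrt≤half⇒ {ε} 0<ε √s≤ε/2 with fromℕ 2 * s ≤? ε * ε
    ... | yes le = le
    ... | no  nle = contradiction ε≤0 (<⇒≱ 0<ε)
      where
      open ≤-Reasoning
      y : Carrier
      y = fromℕ 2 * ε * fromℕ 3 ⁻¹

      3y≈2ε : fromℕ 3 * y ≈ fromℕ 2 * ε
      3y≈2ε = trans (*-comm _ _) (trans (*-assoc _ _ _)
        (trans (*-congˡ (*-inverseˡ (fromℕ-pos 2))) (*-identityʳ _)))

      y²≤s : y * y ≤ s
      y²≤s = *-cancelˡ-≤ (fromℕ-pos 8) (begin
        fromℕ 9 * (y * y)
          ≈⟨ solve 1 (λ y → num 9 :* (y :* y) := (num 3 :* y) :* (num 3 :* y)) refl y ⟩
        (fromℕ 3 * y) * (fromℕ 3 * y)      ≈⟨ *-cong 3y≈2ε 3y≈2ε ⟩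
        (fromℕ 2 * ε) * (fromℕ 2 * ε)
          ≈⟨ solve 1 (λ e → (num 2 :* e) :* (num 2 :* e) := num 4 :* (e :* e)) refl ε ⟩
        fromℕ 4 * (ε * ε)                  ≤⟨ *-monoˡ-≤ (fromℕ-nonneg 4) (≰⇒≥ nle) ⟩
        fromℕ 4 * (fromℕ 2 * s)
          ≤⟨ ≤-by s 0≤s (solve 1 (λ s → num 9 :* s := num 4 :* (num 2 :* s) :+ s) refl s) ⟩
        fromℕ 9 * s                        ∎)

      ε≤0 : ε ≤ 0#
      ε≤0 = +-cancelʳ-≤ (fromℕ 3 * ε) (begin
        ε + fromℕ 3 * ε
          ≈⟨ solve 1 (λ e → e :+ num 3 :* e := num 2 :* (num 2 :* e)) refl ε ⟩
        fromℕ 2 * (fromℕ 2 * ε)            ≈⟨ *-congˡ 3y≈2ε ⟨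
        fromℕ 2 * (fromℕ 3 * y)
          ≤⟨ *-monoˡ-≤ (fromℕ-nonneg 2) (*-monoˡ-≤ (fromℕ-nonneg 3) (≤-trans (≤sqrt y y²≤s) √s≤ε/2)) ⟩
        fromℕ 2 * (fromℕ 3 * (ε / fromℕ 2))
          ≈⟨ solve 2 (λ e h → num 2 :* (num 3 :* (e :* h)) :=
              num 3 :* e :* (h :* num 2)) refl ε (fromℕ 2 ⁻¹) ⟩
        fromℕ 3 * ε * (fromℕ 2 ⁻¹ * fromℕ 2)  ≈⟨ *-congˡ (*-inverseˡ (fromℕ-pos 1)) ⟩
        fromℕ 3 * ε * 1#
          ≈⟨ solve 1 (λ e → num 3 :* e :* num 1 := num 0 :+ num 3 :* e) refl ε ⟩
        0# + fromℕ 3 * ε                   ∎)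

-- Expectations and the collision statistic.

module Expectation (ℝ : RealNumbers) where
  open OrderedField ℝ

  -- The expectation of f i for a sample i from p.
  𝔼 : ∀ {n} → Distribution n → (Fin n → Carrier) → Carrier
  𝔼 p f = sum λ i → prob p i * f i

  sum-mono-≤ : ∀ {n} {f g : Fin n → Carrier} → (∀ i → f i ≤ g i) → sum f ≤ sum g
  sum-mono-≤ {zero}  f≤g = ≤-refl
  sum-mono-≤ {suc n} f≤g = +-mono-≤ (f≤g zero) (sum-mono-≤ λ i → f≤g (suc i))

  sum-nonneg : ∀ {n} {f : Fin n → Carrier} → (∀ i → 0# ≤ f i) → 0# ≤ sum f
  sum-nonneg {zero}  0≤f = ≤-refl
  sum-nonneg {suc n} 0≤f = +-nonneg (0≤f zero) (sum-nonneg λ i → 0≤f (suc i))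

  sum-difference : ∀ {n} (f g : Fin n → Carrier) →
                   sum (λ i → f i - g i) ≈ sum f - sum g
  sum-difference {zero}  f g = solve 0 (num 0 := num 0 :- num 0) refl
  sum-difference {suc n} f g =
    trans (+-congˡ (sum-difference (λ i → f (suc i)) (λ i → g (suc i))))
      (solve 4 (λ a b c d → (a :- b) :+ (c :- d) := (a :+ c) :- (b :+ d)) refl _ _ _ _)

  module _ {n : ℕ} (p : Distribution n) where

    𝔼-cong : ∀ {f g} → (∀ i → f i ≈ g i) → 𝔼 p f ≈ 𝔼 p g
    𝔼-cong f≈g = sum-cong-≋ λ i → *-congˡ (f≈g i)

    𝔼-mono-≤ : ∀ {f g} → (∀ i → f i ≤ g i) → 𝔼 p f ≤ 𝔼 p g
    𝔼-mono-≤ f≤g = sum-mono-≤ λ i → *-monoˡ-≤ (nonneg p i) (f≤g i)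

    𝔼-affine : ∀ a b f → 𝔼 p (λ i → a + b * f i) ≈ a + b * 𝔼 p f
    𝔼-affine a b f = begin-equality
      𝔼 p (λ i → a + b * f i)
        ≈⟨ sum-cong-≋ (λ i → solve 4 (λ p a b f → p :* (a :+ b :* f) :=
            a :* p :+ b :* (p :* f)) refl (prob p i) a b (f i)) ⟩
      sum (λ i → a * prob p i + b * (prob p i * f i))
        ≈⟨ ∑-distrib-+ (λ i → a * prob p i) (λ i → b * (prob p i * f i)) ⟩
      sum (λ i → a * prob p i) + sum (λ i → b * (prob p i * f i))
        ≈⟨ +-cong (*-distribˡ-sum a (prob p)) (*-distribˡ-sum b (λ i → prob p i * f i)) ⟨
      a * sum (prob p) + b * 𝔼 p f
        ≈⟨ +-congʳ (trans (*-congˡ (normalised p)) (*-identityʳ a)) ⟩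
      a + b * 𝔼 p f  ∎
      where open ≤-Reasoning

    𝔼-difference : ∀ a f g → 𝔼 p (λ i → a + (f i - g i)) ≈ a + (𝔼 p f - 𝔼 p g)
    𝔼-difference a f g = begin-equality
      𝔼 p (λ i → a + (f i - g i))       ≈⟨ 𝔼-cong (λ i → +-congˡ (sym (*-identityˡ _))) ⟩
      𝔼 p (λ i → a + 1# * (f i - g i))  ≈⟨ 𝔼-affine a 1# (λ i → f i - g i) ⟩
      a + 1# * 𝔼 p (λ i → f i - g i)    ≈⟨ +-congˡ (*-identityˡ _) ⟩
      a + 𝔼 p (λ i → f i - g i)
        ≈⟨ +-congˡ (sum-cong-≋ λ i → solve 3 (λ p f g → p :* (f :- g) :=
            p :* f :- p :* g) refl (prob p i) (f i) (g i)) ⟩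
      a + sum (λ i → prob p i * f i - prob p i * g i)
        ≈⟨ +-congˡ (sum-difference (λ i → prob p i * f i) (λ i → prob p i * g i)) ⟩
      a + (𝔼 p f - 𝔼 p g)               ∎
      where open ≤-Reasoning

  -- The real indicator of i = j, in the form in which the program computes it.
  matchᶠ : ∀ {n} → Fin n → Fin n → Carrier
  matchᶠ i j = fromℕ (match (toℕ i) (toℕ j))

  matchᶠ-nonneg : ∀ {n} (i j : Fin n) → 0# ≤ matchᶠ i j
  matchᶠ-nonneg i j = fromℕ-nonneg (match (toℕ i) (toℕ j))

  matchᶠ≤1 : ∀ {n} (i j : Fin n) → matchᶠ i j ≤ 1#
  matchᶠ≤1 i j = ≤-respʳ-≈ (+-identityʳ 1#)
    (fromℕ-mono (ℕₚ.m∸n≤m 1 ((toℕ i ℕ.∸ toℕ j) ℕ.+ (toℕ j ℕ.∸ toℕ i))))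

  sum-match : ∀ {n} (v : Fin n → Carrier) i → sum (λ j → v j * matchᶠ i j) ≈ v i
  sum-match {suc n} v zero    = begin-equality
    v zero * (1# + 0#) + sum (λ j → v (suc j) * matchᶠ zero (suc j))
      ≈⟨ +-cong (trans (*-congˡ (+-identityʳ 1#)) (*-identityʳ _)) (sum-cong-≋ (λ (j : Fin n) →
           trans (*-congˡ (reflexive (≡.cong fromℕ (ℕₚ.0∸n≡0 (toℕ j))))) (zeroʳ _))) ⟩
    v zero + sum (λ (_ : Fin n) → 0#)
      ≈⟨ trans (+-congˡ (sum-replicate-zero n)) (+-identityʳ _) ⟩
    v zero ∎
    where open ≤-Reasoning
  sum-match v (suc i) = begin-equality
    v zero * matchᶠ (suc i) zero + sum (λ j → v (suc j) * matchᶠ i j)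
      ≈⟨ +-cong (trans (*-congˡ (reflexive (≡.cong fromℕ (ℕₚ.0∸n≡0 (toℕ i ℕ.+ 0))))) (zeroʳ _))
                (sum-match (λ j → v (suc j)) i) ⟩
    0# + v (suc i)  ≈⟨ +-identityˡ _ ⟩
    v (suc i)       ∎
    where open ≤-Reasoning

  -- The statistic z for samples i, j from p and k, l from q.
  collision : ∀ {n} (i j k l : Fin n) → Carrier
  collision i j k l = (matchᶠ i j - matchᶠ i k) + (matchᶠ k l - matchᶠ j l)

  collision≤2 : ∀ {n} (i j k l : Fin n) → collision i j k l ≤ fromℕ 2
  collision≤2 i j k l = ≤-by (((1# - matchᶠ i j) + matchᶠ i k) + ((1# - matchᶠ k l) + matchᶠ j l))
    (+-nonneg (+-nonneg (difference-nonneg (matchᶠ≤1 i j)) (matchᶠ-nonneg i k))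
              (+-nonneg (difference-nonneg (matchᶠ≤1 k l)) (matchᶠ-nonneg j l)))
    (solve 4 (λ a b c d → num 2 := ((a :- b) :+ (c :- d)) :+
      (((num 1 :- a) :+ b) :+ ((num 1 :- c) :+ d))) refl _ _ _ _)

  -2≤collision : ∀ {n} (i j k l : Fin n) → - fromℕ 2 ≤ collision i j k l
  -2≤collision i j k l = ≤-by ((matchᶠ i j + (1# - matchᶠ i k)) + (matchᶠ k l + (1# - matchᶠ j l)))
    (+-nonneg (+-nonneg (matchᶠ-nonneg i j) (difference-nonneg (matchᶠ≤1 i k)))
              (+-nonneg (matchᶠ-nonneg k l) (difference-nonneg (matchᶠ≤1 j l))))
    (solve 4 (λ a b c d → (a :- b) :+ (c :- d) := (:- num 2) :+
      ((a :+ (num 1 :- b)) :+ (c :+ (num 1 :- d)))) refl _ _ _ _)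

  -- The square of ‖ prob p ⊝ prob q ‖₂.
  distance² : ∀ {n} (p q : Distribution n) → Carrier
  distance² p q = sum λ i → (prob p ⊝ prob q) i ^ 2

  distance²-nonneg : ∀ {n} (p q : Distribution n) → 0# ≤ distance² p q
  distance²-nonneg p q = sum-nonneg λ i →
    ≤-respʳ-≈ (*-congˡ (sym (*-identityʳ _))) (square-nonneg ((prob p ⊝ prob q) i))

  module _ {n : ℕ} (p q : Distribution n) where

    -- The expectation over the four samples of a round.
    𝔼⁴ : (Fin n → Fin n → Fin n → Fin n → Carrier) → Carrier
    𝔼⁴ f = 𝔼 p λ i → 𝔼 p λ j → 𝔼 q λ k → 𝔼 q λ l → f i j k l

    𝔼⁴-mono-≤ : ∀ {f g} → (∀ i j k l → f i j k l ≤ g i j k l) → 𝔼⁴ f ≤ 𝔼⁴ g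
    𝔼⁴-mono-≤ f≤g = 𝔼-mono-≤ p λ i → 𝔼-mono-≤ p λ j → 𝔼-mono-≤ q λ k →
      𝔼-mono-≤ q λ l → f≤g i j k l

    𝔼⁴-affine : ∀ a b f → 𝔼⁴ (λ i j k l → a + b * f i j k l) ≈ a + b * 𝔼⁴ f
    𝔼⁴-affine a b f =
      trans (𝔼-cong p λ i →
        trans (𝔼-cong p λ j →
          trans (𝔼-cong q λ k → 𝔼-affine q a b _) (𝔼-affine q a b _))
        (𝔼-affine p a b _))
      (𝔼-affine p a b _)

    private
      ⟨q,q⟩ ⟨p,q⟩ : Carrier
      ⟨q,q⟩ = 𝔼 q (prob q)
      ⟨p,q⟩ = 𝔼 p (prob q)

      swap : ∀ a b c d → (a - b) + (c - d) ≈ (a - d) + (c - b)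
      swap = solve 4 (λ a b c d → (a :- b) :+ (c :- d) := (a :- d) :+ (c :- b)) refl

      distance²-expand : (⟨q,q⟩ - ⟨p,q⟩) + (𝔼 p (prob p) - ⟨p,q⟩) ≈ distance² p q
      distance²-expand = begin-equality
        (⟨q,q⟩ - ⟨p,q⟩) + (𝔼 p (prob p) - ⟨p,q⟩)
          ≈⟨ +-cong (sum-difference qq pq) (sum-difference pp pq) ⟨
        sum (λ i → qq i - pq i) + sum (λ i → pp i - pq i)
          ≈⟨ ∑-distrib-+ (λ i → qq i - pq i) (λ i → pp i - pq i) ⟨
        sum (λ i → (qq i - pq i) + (pp i - pq i))
          ≈⟨ sum-cong-≋ (λ i → solve 2 (λ p q →
               (q :* q :- p :* q) :+ (p :* p :- p :* q) := (p :- q) :* ((p :- q) :* num 1))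
               refl (prob p i) (prob q i)) ⟩
        distance² p q ∎
        where
        open ≤-Reasoning
        pp pq qq : Fin n → Carrier
        pp i = prob p i * prob p i
        pq i = prob p i * prob q i
        qq i = prob q i * prob q i

    -- The samples are integrated out in the order l, k, j, i; each step uses that
    -- the mean of the indicator of i = j over j is the probability of i.
    𝔼⁴-collision : 𝔼⁴ collision ≈ distance² p q
    𝔼⁴-collision = begin-equality
      𝔼⁴ collision
        ≈⟨ 𝔼-cong p (λ i → 𝔼-cong p λ j → 𝔼-cong q λ k → step q _ k j) ⟩
      𝔼 p (λ i → 𝔼 p λ j → 𝔼 q λ k → (matchᶠ i j - matchᶠ i k) + (prob q k - prob q j))
        ≈⟨ 𝔼-cong p (λ i → 𝔼-cong p λ j → trans (𝔼-cong q λ k → swap _ _ _ _)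
             (trans (𝔼-difference q _ (prob q) (matchᶠ i)) (+-congˡ (+-congˡ (-‿cong (sum-match (prob q) i)))))) ⟩
      𝔼 p (λ i → 𝔼 p λ j → (matchᶠ i j - prob q j) + (⟨q,q⟩ - prob q i))
        ≈⟨ 𝔼-cong p (λ i → trans (𝔼-cong p λ j → +-comm _ _)
             (trans (𝔼-difference p _ (matchᶠ i) (prob q)) (+-congˡ (+-congʳ (sum-match (prob p) i))))) ⟩
      𝔼 p (λ i → (⟨q,q⟩ - prob q i) + (prob p i - ⟨p,q⟩))
        ≈⟨ 𝔼-cong p (λ i → swap _ _ _ _) ⟩
      𝔼 p (λ i → (⟨q,q⟩ - ⟨p,q⟩) + (prob p i - prob q i))
        ≈⟨ 𝔼-difference p _ (prob p) (prob q) ⟩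
      (⟨q,q⟩ - ⟨p,q⟩) + (𝔼 p (prob p) - ⟨p,q⟩)
        ≈⟨ distance²-expand ⟩
      distance² p q ∎
      where
      open ≤-Reasoning
      step : ∀ {m} (r : Distribution m) a k j →
             𝔼 r (λ l → a + (matchᶠ k l - matchᶠ j l)) ≈ a + (prob r k - prob r j)
      step r a k j = trans (𝔼-difference r a (matchᶠ k) (matchᶠ j))
        (+-congˡ (+-cong (sum-match (prob r) k) (-‿cong (sum-match (prob r) j))))

    -- A pointwise lower bound that is affine in z becomes one for the expectation,
    -- with z replaced by its mean.
    𝔼⁴-lower-bound : ∀ α β γ {f} → (∀ i j k l → β + γ * collision i j k l ≤ α * f i j k l) →
                     β + γ * distance² p q ≤ α * 𝔼⁴ f
    𝔼⁴-lower-bound α β γ {f} bound = begin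
      β + γ * distance² p q                       ≈⟨ +-congˡ (*-congˡ 𝔼⁴-collision) ⟨
      β + γ * 𝔼⁴ collision                        ≈⟨ 𝔼⁴-affine β γ collision ⟨
      𝔼⁴ (λ i j k l → β + γ * collision i j k l)  ≤⟨ 𝔼⁴-mono-≤ bound ⟩
      𝔼⁴ (λ i j k l → α * f i j k l)
        ≤⟨ 𝔼⁴-mono-≤ (λ i j k l → ≤-reflexive (sym (+-identityˡ _))) ⟩
      𝔼⁴ (λ i j k l → 0# + α * f i j k l)         ≈⟨ 𝔼⁴-affine 0# α f ⟩
      0# + α * 𝔼⁴ f                               ≈⟨ +-identityˡ _ ⟩
      α * 𝔼⁴ f                                    ∎
      where open ≤-Reasoning

    distance²≤2 : distance² p q ≤ fromℕ 2
    distance²≤2 = +-cancelʳ-≤ (- fromℕ 2) (begin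
      distance² p q + - fromℕ 2
        ≈⟨ solve 1 (λ d → d :- num 2 := :- num 2 :+ num 1 :* d) refl (distance² p q) ⟩
      - fromℕ 2 + 1# * distance² p q
        ≤⟨ 𝔼⁴-lower-bound 0# (- fromℕ 2) 1# {λ _ _ _ _ → 0#} (λ i j k l →
         ≤-by (fromℕ 2 - collision i j k l) (difference-nonneg (collision≤2 i j k l))
           (solve 1 (λ z → num 0 :* num 0 :=
               (:- num 2 :+ num 1 :* z) :+ (num 2 :- z)) refl (collision i j k l))) ⟩
      0# * 𝔼⁴ (λ _ _ _ _ → 0#)        ≈⟨ zeroˡ _ ⟩
      0#                              ≈⟨ -‿inverseʳ _ ⟨
      fromℕ 2 + - fromℕ 2             ∎)
      where open ≤-Reasoning

-- Running time and correctness of the program.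

⌊⌋-true : ∀ {A : Set} (A? : Dec A) → A → ⌊ A? ⌋ ≡ true
⌊⌋-true A? a = ≡.trans (isYes≗does A?) (dec-true A? a)

⌊⌋-false : ∀ {A : Set} (A? : Dec A) → ¬ A → ⌊ A? ⌋ ≡ false
⌊⌋-false A? ¬a = ≡.trans (isYes≗does A?) (dec-false A? ¬a)

module Analysis (ℝ : RealNumbers) where
  open OrderedField ℝ
  open Expectation ℝ
  open Execution ℝ

  m : Carrier
  m = fromℕ scale

  -- Rounds δ r N D w: started with the values D and w of its variables 3 and
  -- 4, where w is multiplied by r in each round, the loop makes N rounds.
  data Rounds (δ r : Carrier) : ℕ → Carrier → Carrier → Set where
    stop : ∀ {D w} → ¬ δ * D ≤ w → Rounds δ r 0 D w
    go   : ∀ {N D w} → δ * D ≤ w → Rounds δ r N (D * m) (w * r) →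
           Rounds δ r (suc N) D w

  -- If the loop condition would fail after B rounds, then the loop ends after at
  -- most B rounds.
  count-rounds : ∀ {δ r} B {D w} → ¬ δ * (D * m ^ B) ≤ w * r ^ B →
                 ∃[ N ] (N ℕ.≤ B × Rounds δ r N D w)
  count-rounds {δ} {r} B {D} {w} short with δ * D ≤? w
  ... | no  stops = 0 , z≤n , stop stops
  count-rounds {δ} {r} zero {D} {w} short | yes goes = contradiction
    (≤-respˡ-≈ (*-congˡ (sym (*-identityʳ D))) (≤-respʳ-≈ (sym (*-identityʳ w)) goes)) short
  count-rounds {δ} {r} (suc B) {D} {w} short | yes goes =
    let N , N≤B , rounds = count-rounds B λ le → short
          (≤-respˡ-≈ (*-congˡ (*-assoc D m (m ^ B))) (≤-respʳ-≈ (*-assoc w r (r ^ B)) le))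
    in suc N , s≤s N≤B , go goes rounds

  module _ {u : Carrier} (0≤r : 0# ≤ m - u) where
    private
      r : Carrier
      r = m - u

      m-pos : 0# < m
      m-pos = fromℕ-pos (ℕ.pred scale)

    -- Bernoulli's inequality in the form (1 - v) ^ k (1 + k v) ≤ 1 for v = u / m,
    -- which follows by induction from (1 - v)(1 + (k + 1) v) ≤ 1 + k v.
    bernoulli : ∀ k → r ^ k * (m + fromℕ k * u) ≤ m ^ k * m
    bernoulli zero    = ≤-reflexive
      (solve 2 (λ m u → num 1 :* (m :+ num 0 :* u) := num 1 :* m) refl m u)
    bernoulli (suc k) = begin
      r * r ^ k * (m + (1# + fromℕ k) * u)
        ≤⟨ ≤-by (r ^ k * ((1# + fromℕ k) * (u * u)))
             (*-nonneg (^-nonneg 0≤r k) (*-nonneg (fromℕ-nonneg (suc k)) (square-nonneg u)))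
             (solve 4 (λ p m u k → m :* (p :* (m :+ k :* u)) :=
                (m :- u) :* p :* (m :+ (num 1 :+ k) :* u) :+ p :* ((num 1 :+ k) :* (u :* u)))
               refl (r ^ k) m u (fromℕ k)) ⟩
      m * (r ^ k * (m + fromℕ k * u))  ≤⟨ *-monoˡ-≤ (proj₁ m-pos) (bernoulli k) ⟩
      m * (m ^ k * m)                  ≈⟨ *-assoc m (m ^ k) m ⟨
      m * m ^ k * m                    ∎
      where open ≤-Reasoning

    halving : ∀ k → m ≤ fromℕ k * u → fromℕ 2 * r ^ k ≤ m ^ k
    halving k m≤ku = *-cancelˡ-≤ m-pos (begin
      m * (fromℕ 2 * r ^ k)
        ≈⟨ solve 2 (λ m p → m :* (num 2 :* p) := p :* (m :+ m)) refl m (r ^ k) ⟩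
      r ^ k * (m + m)              ≤⟨ *-monoˡ-≤ (^-nonneg 0≤r k) (+-mono-≤ ≤-refl m≤ku) ⟩
      r ^ k * (m + fromℕ k * u)    ≤⟨ bernoulli k ⟩
      m ^ k * m                    ≈⟨ *-comm _ _ ⟩
      m * m ^ k                    ∎)
      where open ≤-Reasoning

    halving-repeatedly : ∀ k → m ≤ fromℕ k * u → ∀ L →
                         fromℕ 2 ^ L * r ^ (k ℕ.* L) ≤ m ^ (k ℕ.* L)
    halving-repeatedly k m≤ku L = begin
      fromℕ 2 ^ L * r ^ (k ℕ.* L)  ≈⟨ *-congˡ (^-assocʳ r k L) ⟨
      fromℕ 2 ^ L * (r ^ k) ^ L    ≈⟨ ^-distrib-* (fromℕ 2) (r ^ k) L ⟨
      (fromℕ 2 * r ^ k) ^ L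
        ≤⟨ ^-mono-≤ (*-nonneg (fromℕ-nonneg 2) (^-nonneg 0≤r k)) (halving k m≤ku) L ⟩
      (m ^ k) ^ L                  ≈⟨ ^-assocʳ m k L ⟩
      m ^ (k ℕ.* L)                ∎
      where open ≤-Reasoning

    few-rounds : ∀ {δ} → 0# < δ → ∀ k → m ≤ fromℕ k * u → ∀ L → ¬ fromℕ 2 ^ L ≤ δ ⁻¹ →
                 ∃[ N ] (N ℕ.≤ k ℕ.* L × Rounds δ r N (fromℕ 1) (fromℕ 1))
    few-rounds {δ} 0<δ k m≤ku L 2^L≰δ⁻¹ = count-rounds (k ℕ.* L) λ le → 2^L≰δ⁻¹
      (*-cancelˡ-≤ (*-pos 0<δ (^-pos m-pos (k ℕ.* L))) (begin
        (δ * m ^ (k ℕ.* L)) * fromℕ 2 ^ L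
          ≈⟨ solve 3 (λ d p t → d :* p :* t :=
              t :* (d :* ((num 1 :+ num 0) :* p))) refl δ (m ^ (k ℕ.* L)) (fromℕ 2 ^ L) ⟩
        fromℕ 2 ^ L * (δ * (fromℕ 1 * m ^ (k ℕ.* L)))
          ≤⟨ *-monoˡ-≤ (^-nonneg (fromℕ-nonneg 2) L) le ⟩
        fromℕ 2 ^ L * (fromℕ 1 * r ^ (k ℕ.* L))
          ≈⟨ *-congˡ (trans (*-congʳ (+-identityʳ 1#)) (*-identityˡ _)) ⟩
        fromℕ 2 ^ L * r ^ (k ℕ.* L)
          ≤⟨ halving-repeatedly k m≤ku L ⟩
        m ^ (k ℕ.* L)
          ≈⟨ trans (*-congʳ (*-inverseˡ 0<δ)) (*-identityˡ _) ⟨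
        (δ ⁻¹ * δ) * m ^ (k ℕ.* L)
          ≈⟨ solve 3 (λ i d p → (i :* d) :* p := (d :* p) :* i) refl (δ ⁻¹) δ (m ^ (k ℕ.* L)) ⟩
        (δ * m ^ (k ℕ.* L)) * δ ⁻¹  ∎))
      where open ≤-Reasoning

  module _ (σ : Store) where
    δ-of D-of w-of r-of : Carrier
    δ-of = reals σ 0
    D-of = reals σ 3
    w-of = reals σ 4
    r-of = m - (reals σ 1 * reals σ 1) * (reals σ 1 * reals σ 1)

    -- The store after one round in which the samples i, j, k, l are drawn.
    next : (i j k l : ℕ) → Store
    next i j k l = σ₃
      where
      σ₀ = setₙ 3 l (setₙ 2 k (setₙ 1 j (setₙ 0 i σ)))
      σ₁ = setᵣ 2 (evalᵣ (rvar 2 ⊠ factor) σ₀) σ₀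
      σ₂ = setᵣ 3 (evalᵣ (rvar 3 ⊠ real (lit scale)) σ₁) σ₁
      σ₃ = setᵣ 4 (evalᵣ (rvar 4 ⊠ (real (lit scale) ⊟ ε² ⊠ ε²)) σ₂) σ₂

  -- A round takes 13 steps and the evaluation of the loop condition one; the
  -- condition is evaluated once more at the end.
  loopTime : ℕ → ℕ
  loopTime N = suc (N ℕ.* 14)

  module _ (n : ℕ) where

    branch-halts : ∀ b c d σ t {v} → holds b σ ≡ v →
                   HaltsWithin n t ((if v then c else d) ∷ [] , σ) →
                   HaltsWithin n (suc t) (branch b c d ∷ [] , σ)
    branch-halts b c d σ t ≡.refl halts = halts

    loop-halts : ∀ N σ → Rounds (δ-of σ) (r-of σ) N (D-of σ) (w-of σ) →
                 HaltsWithin n (loopTime N) (loop ∷ [] , σ)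
    loop-halts zero    σ (stop stops) = ≡.subst
      (λ b → HaltsWithin n 0 ((if b then round ∷ loop ∷ [] else []) , σ))
      (≡.sym (⌊⌋-false (δ-of σ * D-of σ ≤? w-of σ) stops)) tt
    loop-halts (suc N) σ (go goes rounds) = ≡.subst
      (λ b → HaltsWithin n (suc N ℕ.* 14) ((if b then round ∷ loop ∷ [] else []) , σ))
      (≡.sym (⌊⌋-true (δ-of σ * D-of σ ≤? w-of σ) goes))
      λ i j k l → loop-halts N (next σ (toℕ i) (toℕ j) (toℕ k) (toℕ l)) rounds

  -- The factor by which a round with statistic z multiplies U.
  factorᶻ : Carrier → Carrier → Carrier
  factorᶻ x z = m + fromℕ 2 * x * (fromℕ 4 * z - fromℕ 3 * x)

  module _ {n : ℕ} (p q : Distribution n) where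

    branch-outcome : ∀ b c d σ v t {w} → holds b σ ≡ w →
                     outcome tester p q v (suc t) (branch b c d ∷ [] , σ) ≡
                     outcome tester p q v t ((if w then c else d) ∷ [] , σ)
    branch-outcome b c d σ v t ≡.refl = ≡.refl

    private
      verdictᵗ : Bool → Bool → Carrier
      verdictᵗ = verdict tester p q

    -- A potential for the verdict v is a quantity V that controls the probability
    -- of the opposite verdict: it is related to D and U by an invariant, is at
    -- least D at the end if the verdict is not v, and is multiplied in each round
    -- by c + d z, which has mean at most r = m - x².
    record Potential (v : Bool) (x : Carrier) : Set₁ where
      field
        Inv       : (D U V : Carrier) → Set
        V-nonneg  : ∀ {D U V} → Inv D U V → 0# ≤ V
        final     : ∀ {D U V} → Inv D U V →
                    (verdictᵗ v ⌊ U ≤? D ⌋ ≡ 1#) ⊎ (verdictᵗ v ⌊ U ≤? D ⌋ ≡ 0# × D ≤ V)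
        c d       : Carrier
        preserved : ∀ {D U V z} → - fromℕ 2 ≤ z → z ≤ fromℕ 2 → Inv D U V →
                    Inv (D * m) (U * factorᶻ x z) (V * (c + d * z))
        mean      : c + d * distance² p q ≤ m - x * x

    -- Whenever the loop condition is about to be evaluated, the probability O of
    -- the verdict v satisfies w (1 - O) ≤ δ V, where w is the current power of r.
    -- At the end this holds because w < δ D, and D ≤ V unless the verdict is v.
    -- One round multiplies w by r, and V by at most r in the mean.
    loop-correct : ∀ {v δ ε} → 0# ≤ δ → 0# < m - (ε * ε) * (ε * ε) →
                   (P : Potential v (ε * ε)) → let open Potential P in
                   ∀ N σ V → δ-of σ ≡ δ → reals σ 1 ≡ ε →
                   Rounds (δ-of σ) (r-of σ) N (D-of σ) (w-of σ) →
                   Inv (D-of σ) (reals σ 2) V →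
                   w-of σ ≤ w-of σ * outcome tester p q v (loopTime N) (loop ∷ [] , σ) + δ * V
    loop-correct {v} {δ} 0≤δ 0<r P zero σ V ≡.refl ≡.refl (stop stops) inv = begin
      w          ≤⟨ conclude (Potential.final P inv) ⟩
      w * verdictᵗ v ⌊ reals σ 2 ≤? D-of σ ⌋ + δ * V
                 ≡⟨ ≡.cong (λ o → w * o + δ * V) outcome≡ ⟨
      w * outcome tester p q v 1 (loop ∷ [] , σ) + δ * V  ∎
      where
      open ≤-Reasoning
      w : Carrier
      w = w-of σ

      outcome≡ : outcome tester p q v 1 (loop ∷ [] , σ) ≡ verdictᵗ v ⌊ reals σ 2 ≤? D-of σ ⌋
      outcome≡ = ≡.cong (λ b → outcome tester p q v 0 ((if b then round ∷ loop ∷ [] else []) , σ))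
        (⌊⌋-false (δ * D-of σ ≤? w) stops)

      conclude : ∀ {o} → (o ≡ 1#) ⊎ (o ≡ 0# × D-of σ ≤ V) → w ≤ w * o + δ * V
      conclude (inj₁ ≡.refl)         = ≤-by (δ * V) (*-nonneg 0≤δ (Potential.V-nonneg P inv))
        (+-congʳ (*-identityʳ w))
      conclude (inj₂ (≡.refl , D≤V)) = begin
        w               ≤⟨ ≰⇒≥ stops ⟩
        δ * D-of σ      ≤⟨ *-monoˡ-≤ 0≤δ D≤V ⟩
        δ * V           ≈⟨ solve 2 (λ w y → y := w :* num 0 :+ y) refl w (δ * V) ⟩
        w * 0# + δ * V  ∎
    loop-correct {v} {δ} {ε} 0≤δ 0<r P (suc N) σ V ≡.refl ≡.refl (go goes rounds) inv =
      *-cancelˡ-≤ 0<r (begin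
        r * w
          ≈⟨ solve 5 (λ r w y c e → r :* w :=
              (w :* r :- y :* c) :+ (:- (y :* e)) :+ y :* (c :+ e)) refl r w (δ * V) c (d * s) ⟩
        (w * r - δ * V * c) + - (δ * V * (d * s)) + δ * V * (c + d * s)
          ≤⟨ +-mono-≤ averaged (*-monoˡ-≤ (*-nonneg 0≤δ (V-nonneg inv)) mean) ⟩
        w * r * 𝔼⁴ p q o + δ * V * r          ≡⟨ ≡.cong (λ o → w * r * o + δ * V * r) outcome≡ ⟨
        w * r * O + δ * V * r
          ≈⟨ solve 4 (λ w r o y → w :* r :* o :+ y :* r :=
              r :* (w :* o :+ y)) refl w r O (δ * V) ⟩
        r * (w * O + δ * V)                   ∎)
      where
      open ≤-Reasoning
      open Potential P
      w r s O : Carrier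
      w = w-of σ
      r = r-of σ
      s = distance² p q
      O = outcome tester p q v (loopTime (suc N)) (loop ∷ [] , σ)

      σ′ : (i j k l : Fin n) → Store
      σ′ i j k l = next σ (toℕ i) (toℕ j) (toℕ k) (toℕ l)

      o : (i j k l : Fin n) → Carrier
      o i j k l = outcome tester p q v (loopTime N) (loop ∷ [] , σ′ i j k l)

      outcome≡ : O ≡ 𝔼⁴ p q o
      outcome≡ = ≡.cong
        (λ b → outcome tester p q v (suc N ℕ.* 14) ((if b then round ∷ loop ∷ [] else []) , σ))
        (⌊⌋-true (δ * D-of σ ≤? w) goes)

      one-sample : ∀ i j k l →
        (w * r - δ * V * c) + - (δ * V * d) * collision i j k l ≤ w * r * o i j k l
      one-sample i j k l = +-cancelʳ-≤ (δ * (V * (c + d * z))) (begin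
        (w * r - δ * V * c) + - (δ * V * d) * z + δ * (V * (c + d * z))
          ≈⟨ solve 6 (λ a y c d v z →
               (a :- y :* v :* c) :+ (:- (y :* v :* d)) :* z :+ y :* (v :* (c :+ d :* z)) := a)
               refl (w * r) δ c d V z ⟩
        w * r
          ≤⟨ loop-correct 0≤δ 0<r P N (σ′ i j k l) (V * (c + d * z)) ≡.refl ≡.refl rounds
               (preserved (-2≤collision i j k l) (collision≤2 i j k l) inv) ⟩
        w * r * o i j k l + δ * (V * (c + d * z))  ∎)
        where
        z : Carrier
        z = collision i j k l

      averaged : (w * r - δ * V * c) + - (δ * V * (d * s)) ≤ w * r * 𝔼⁴ p q o
      averaged = begin
        (w * r - δ * V * c) + - (δ * V * (d * s))
          ≈⟨ +-congˡ (solve 3 (λ y d s → :- (y :* (d :* s)) :=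
              (:- (y :* d)) :* s) refl (δ * V) d s) ⟩
        (w * r - δ * V * c) + - (δ * V * d) * s
          ≤⟨ 𝔼⁴-lower-bound p q (w * r) _ _ one-sample ⟩
        w * r * 𝔼⁴ p q o                           ∎

    module _ {x : Carrier} (0≤x : 0# ≤ x) (x≤2 : x ≤ fromℕ 2) where
      private
        s : Carrier
        s = distance² p q

        0≤2x : 0# ≤ fromℕ 2 * x
        0≤2x = *-nonneg (fromℕ-nonneg 2) 0≤x

        -- The quantity y = 4z - 3x.
        increment : Carrier → Carrier
        increment z = fromℕ 4 * z - fromℕ 3 * x

        module _ {z : Carrier} (-2≤z : - fromℕ 2 ≤ z) (z≤2 : z ≤ fromℕ 2) where

          -14≤increment : 0# ≤ fromℕ 14 + increment z
          -14≤increment = ≤-respʳ-≈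
            (solve 2 (λ x z → num 4 :* (z :- :- num 2) :+ num 3 :* (num 2 :- x) :=
              num 14 :+ (num 4 :* z :- num 3 :* x)) refl x z)
            (+-nonneg (*-nonneg (fromℕ-nonneg 4) (difference-nonneg -2≤z))
                      (*-nonneg (fromℕ-nonneg 3) (difference-nonneg x≤2)))

          increment≤14 : 0# ≤ fromℕ 14 - increment z
          increment≤14 = ≤-respʳ-≈
            (solve 2 (λ x z → num 4 :* (num 2 :- z) :+ (num 3 :* x :+ num 6) :=
              num 14 :- (num 4 :* z :- num 3 :* x)) refl x z)
            (+-nonneg (*-nonneg (fromℕ-nonneg 4) (difference-nonneg z≤2))
                      (+-nonneg (*-nonneg (fromℕ-nonneg 3) 0≤x) (fromℕ-nonneg 6)))

          0≤28[2-x] : 0# ≤ fromℕ 28 * (fromℕ 2 - x)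
          0≤28[2-x] = *-nonneg (fromℕ-nonneg 28) (difference-nonneg x≤2)

          factor-nonneg : 0# ≤ factorᶻ x z
          factor-nonneg = ≤-respʳ-≈
            (solve 2 (λ x y → num 784 :+ num 28 :* (num 2 :- x) :+ num 2 :* x :* (num 14 :+ y) :=
              num 840 :+ num 2 :* x :* y) refl x (increment z))
            (+-nonneg (+-nonneg (fromℕ-nonneg 784) 0≤28[2-x]) (*-nonneg 0≤2x -14≤increment))

          -- The factor m - 2xy + x² of V in the far case.
          opposite-nonneg : 0# ≤ (m + fromℕ 7 * (x * x)) + - (fromℕ 8 * x) * z
          opposite-nonneg = ≤-respʳ-≈
            (solve 2 (λ x z →
              num 784 :+ num 28 :* (num 2 :- x)
                :+ num 2 :* x :* (num 14 :- (num 4 :* z :- num 3 :* x)) :+ x :* x :=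
              (num 840 :+ num 7 :* (x :* x)) :+ (:- (num 8 :* x)) :* z) refl x z)
            (+-nonneg (+-nonneg (+-nonneg (fromℕ-nonneg 784) 0≤28[2-x])
                                (*-nonneg 0≤2x increment≤14))
                      (square-nonneg x))

          -- The difference is x² (m + 2xy - 4y²), where
          -- 4y² = 4 · 14² - 4 (14 - y)(14 + y).
          m²≤factor*opposite : m * m ≤ factorᶻ x z * ((m + fromℕ 7 * (x * x)) + - (fromℕ 8 * x) * z)
          m²≤factor*opposite = ≤-by
            (x * x * (fromℕ 2 * x * (fromℕ 14 + y) + fromℕ 28 * (fromℕ 2 - x)
                      + fromℕ 4 * ((fromℕ 14 - y) * (fromℕ 14 + y))))
            (*-nonneg (square-nonneg x) (+-nonneg (+-nonneg (*-nonneg 0≤2x -14≤increment) 0≤28[2-x])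
              (*-nonneg (fromℕ-nonneg 4) (*-nonneg increment≤14 -14≤increment))))
            (solve 2 (λ x z → let m = num 840; y = num 4 :* z :- num 3 :* x in
               (m :+ num 2 :* x :* y) :* ((m :+ num 7 :* (x :* x)) :+ (:- (num 8 :* x)) :* z) :=
               m :* m :+ x :* x :* (num 2 :* x :* (num 14 :+ y) :+ num 28 :* (num 2 :- x) :+
                 num 4 :* ((num 14 :- y) :* (num 14 :+ y)))) refl x z)
            where
            y : Carrier
            y = increment z

      -- V = U, and c + d z is the factor of U itself.
      close-potential : fromℕ 2 * s ≤ x → Potential true x
      close-potential 2s≤x = record
        { Inv       = λ D U V → U ≈ V × 0# ≤ V
        ; V-nonneg  = proj₂
        ; final     = λ {D} {U} (U≈V , 0≤V) → final (U ≤? D) U≈V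
        ; c         = m - fromℕ 6 * (x * x)
        ; d         = fromℕ 8 * x
        ; preserved = λ {D} {U} {V} {z} -2≤z z≤2 (U≈V , 0≤V) →
            let same = solve 3 (λ m x z → m :+ num 2 :* x :* (num 4 :* z :- num 3 :* x) :=
                         (m :- num 6 :* (x :* x)) :+ num 8 :* x :* z) refl m x z
            in *-cong U≈V same , *-nonneg 0≤V (≤-respʳ-≈ same (factor-nonneg -2≤z z≤2))
        ; mean      = ≤-by (fromℕ 4 * x * (x - fromℕ 2 * s) + x * x)
            (+-nonneg (*-nonneg (*-nonneg (fromℕ-nonneg 4) 0≤x) (difference-nonneg 2s≤x)) (square-nonneg x))
            (solve 3 (λ m x s → m :- x :* x := ((m :- num 6 :* (x :* x)) :+ num 8 :* x :* s) :+
              (num 4 :* x :* (x :- num 2 :* s) :+ x :* x)) refl m x s)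
        }
        where
        final : ∀ {D U V} (d? : Dec (U ≤ D)) → U ≈ V →
                (verdictᵗ true ⌊ d? ⌋ ≡ 1#) ⊎ (verdictᵗ true ⌊ d? ⌋ ≡ 0# × D ≤ V)
        final (yes _)   U≈V = inj₁ ≡.refl
        final (no U≰D)  U≈V = inj₂ (≡.refl , ≤-respʳ-≈ U≈V (≰⇒≥ U≰D))

      -- V is the product of the factors m - 2xy + x², and c + d z is such a factor as a
      -- polynomial in z.
      far-potential : x ≤ s → Potential false x
      far-potential x≤s = record
        { Inv       = λ D U V → 0# < D × 0# ≤ V × D * D ≤ U * V
        ; V-nonneg  = λ (_ , 0≤V , _) → 0≤V
        ; final     = λ {D} {U} (0<D , 0≤V , D²≤UV) → final (U ≤? D) 0<D 0≤V D²≤UV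
        ; c         = m + fromℕ 7 * (x * x)
        ; d         = - (fromℕ 8 * x)
        ; preserved = λ {D} {U} {V} {z} -2≤z z≤2 (0<D , 0≤V , D²≤UV) →
            *-pos 0<D (fromℕ-pos (ℕ.pred scale)) ,
            *-nonneg 0≤V (opposite-nonneg -2≤z z≤2) ,
            (begin
              D * m * (D * m)      ≈⟨ interchange D m D m ⟩
              D * D * (m * m)      ≤⟨ *-mono-≤ (square-nonneg D)
                                        (*-nonneg (factor-nonneg -2≤z z≤2) (opposite-nonneg -2≤z z≤2))
                                        D²≤UV (m²≤factor*opposite -2≤z z≤2) ⟩
              U * V * (factorᶻ x z * ((m + fromℕ 7 * (x * x)) + - (fromℕ 8 * x) * z))
                                   ≈⟨ interchange U V _ _ ⟩
              U * factorᶻ x z * (V * ((m + fromℕ 7 * (x * x)) + - (fromℕ 8 * x) * z))  ∎)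
        ; mean      = ≤-by (fromℕ 8 * x * (s - x))
            (*-nonneg (*-nonneg (fromℕ-nonneg 8) 0≤x) (difference-nonneg x≤s))
            (solve 3 (λ m x s → m :- x :* x :=
                ((m :+ num 7 :* (x :* x)) :+ (:- (num 8 :* x)) :* s) :+
              num 8 :* x :* (s :- x)) refl m x s)
        }
        where
        open ≤-Reasoning
        interchange : ∀ a b c d → a * b * (c * d) ≈ a * c * (b * d)
        interchange = solve 4 (λ a b c d → a :* b :* (c :* d) := a :* c :* (b :* d)) refl

        final : ∀ {D U V} (d? : Dec (U ≤ D)) → 0# < D → 0# ≤ V → D * D ≤ U * V →
                (verdictᵗ false ⌊ d? ⌋ ≡ 1#) ⊎ (verdictᵗ false ⌊ d? ⌋ ≡ 0# × D ≤ V)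
        final         (no _)    0<D 0≤V D²≤UV = inj₁ ≡.refl
        final {D} {U} {V} (yes U≤D) 0<D 0≤V D²≤UV = inj₂ (≡.refl ,
          *-cancelˡ-≤ 0<D (begin
            D * D  ≤⟨ D²≤UV ⟩
            U * V  ≈⟨ *-comm U V ⟩
            V * U  ≤⟨ *-monoˡ-≤ 0≤V U≤D ⟩
            V * D  ≈⟨ *-comm V D ⟩
            D * V  ∎))

  -- There are at most 9 + 14N steps, and the number N of rounds is at most
  -- (844 / ε⁴)(2 log₂ (1 / δ)), where 844 = m + 4 bounds m + x².
  budget : ℕ
  budget = 9 ℕ.+ 14 ℕ.* (2 ℕ.* 844)

  -- The properties required of the tester for given n, δ and ε.
  Guarantee : (n : ℕ) (δ ε : Carrier) → Set
  Guarantee n δ ε =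
    Σ[ t ∈ ℕ ]
      (fromℕ t ≤ fromℕ budget * (1# + (ε ⁻¹) ^ 4 * log₂ (δ ⁻¹)) ×
       HaltsWithin n t (start tester δ ε) ×
       ((p q : Distribution n) →
         (‖ prob p ⊝ prob q ‖₂ ≤ ε / fromℕ 2 → 1# - δ ≤ Pr-accepts tester δ ε t p q) ×
         (ε < ‖ prob p ⊝ prob q ‖₂ → 1# - δ ≤ Pr-rejects tester δ ε t p q)))

  module _ (n : ℕ) {δ ε : Carrier} (0<δ : 0# < δ) (δ<1 : δ < 1#) (0<ε : 0# < ε) where
    private
      x g ℓ : Carrier
      x = ε * ε
      g = (ε ⁻¹) ^ 4
      ℓ = log₂ (δ ⁻¹)

      0≤δ : 0# ≤ δ
      0≤δ = proj₁ 0<δ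

      0<x : 0# < x
      0<x = *-pos 0<ε 0<ε

      0≤x : 0# ≤ x
      0≤x = proj₁ 0<x

      1≤δ⁻¹ : 1# ≤ δ ⁻¹
      1≤δ⁻¹ = *-cancelˡ-≤ 0<δ (begin
        δ * 1#    ≈⟨ *-identityʳ δ ⟩
        δ         ≤⟨ proj₁ δ<1 ⟩
        1#        ≈⟨ *-inverseʳ δ (pos⇒≉0 0<δ) ⟨
        δ * δ ⁻¹  ∎)
        where open ≤-Reasoning

      0≤g : 0# ≤ g
      0≤g = ^-nonneg (⁻¹-nonneg 0<ε) 4

      0≤ℓ : 0# ≤ ℓ
      0≤ℓ = fromℕ≤log₂ 1≤δ⁻¹ 0 1≤δ⁻¹

      0≤gℓ : 0# ≤ g * ℓ
      0≤gℓ = *-nonneg 0≤g 0≤ℓ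

      constant-time : ∀ {t} → t ℕ.≤ budget → fromℕ t ≤ fromℕ budget * (1# + g * ℓ)
      constant-time {t} t≤ = begin
        fromℕ t                              ≤⟨ fromℕ-mono t≤ ⟩
        fromℕ budget
          ≤⟨ ≤-by (fromℕ budget * (g * ℓ)) (*-nonneg (fromℕ-nonneg budget) 0≤gℓ)
               (solve 2 (λ b y → b :* (num 1 :+ y) := b :+ b :* y) refl (fromℕ budget) (g * ℓ)) ⟩
        fromℕ budget * (1# + g * ℓ)          ∎
        where open ≤-Reasoning

      far⇒ : (p q : Distribution n) → ε < ‖ prob p ⊝ prob q ‖₂ → ¬ distance² p q ≤ x
      far⇒ p q = <sqrt⇒square< (distance²-nonneg p q) (proj₁ 0<ε)

      close⇒ : (p q : Distribution n) → ‖ prob p ⊝ prob q ‖₂ ≤ ε / fromℕ 2 →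
               fromℕ 2 * distance² p q ≤ x
      close⇒ p q = sqrt≤half⇒ (distance²-nonneg p q) 0<ε

      σ₀ : Store
      σ₀ = initial δ ε

    guarantee-δ-large : fromℕ 1 ≤ fromℕ 2 * δ → Guarantee n δ ε
    guarantee-δ-large 1≤2δ = 4 , constant-time (ℕₚ.m≤m+n 4 _) ,
      branch-halts n δ-large coinFlip sampling σ₀ 3 large (λ _ → tt) , λ p q →
        (λ _ → half-suffices true p q (coin≡ true p q) (+-identityˡ 1#)) ,
        (λ _ → half-suffices false p q (coin≡ false p q) (+-identityʳ 1#))
      where
      open ≤-Reasoning
      large : holds δ-large σ₀ ≡ true
      large = ⌊⌋-true (fromℕ 1 ≤? fromℕ 2 * δ) 1≤2δ

      heads : ⌊ fromℕ 1 ≤? 0# ⌋ ≡ false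
      heads = ⌊⌋-false (fromℕ 1 ≤? 0#) (<⇒≱ (fromℕ-pos 0))

      tails : ⌊ 0# ≤? 0# ⌋ ≡ true
      tails = ⌊⌋-true (0# ≤? 0#) ≤-refl

      coin≡ : ∀ v (p q : Distribution n) →
              outcome tester p q v 3 (coinFlip ∷ [] , σ₀) ≡
              (verdict tester p q v false + verdict tester p q v true) / fromℕ 2
      coin≡ v p q = ≡.cong₂
        (λ a b → (verdict tester p q v a + verdict tester p q v b) / fromℕ 2) heads tails

      half-suffices : ∀ v (p q : Distribution n) {y} →
                  outcome tester p q v 3 (coinFlip ∷ [] , σ₀) ≡ y / fromℕ 2 → y ≈ 1# →
                  1# - δ ≤ outcome tester p q v 4 (start tester δ ε)
      half-suffices v p q {y} is-half y≈1 = *-cancelˡ-≤ (fromℕ-pos 1) (begin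
        fromℕ 2 * (1# - δ)
          ≤⟨ ≤-by (fromℕ 2 * δ - fromℕ 1) (difference-nonneg 1≤2δ)
               (solve 1 (λ d → num 1 :=
                 num 2 :* (num 1 :- d) :+ (num 2 :* d :- (num 1 :+ num 0))) refl δ) ⟩
        1#                          ≈⟨ y≈1 ⟨
        y                           ≈⟨ *-identityʳ y ⟨
        y * 1#                      ≈⟨ *-congˡ (*-inverseʳ _ (pos⇒≉0 (fromℕ-pos 1))) ⟨
        y * (fromℕ 2 * fromℕ 2 ⁻¹)
          ≈⟨ solve 3 (λ y t h → y :* (t :* h) := t :* (y :* h)) refl y (fromℕ 2) (fromℕ 2 ⁻¹) ⟩
        fromℕ 2 * (y / fromℕ 2)
          ≡⟨ ≡.cong (fromℕ 2 *_) (≡.trans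
               (branch-outcome p q δ-large coinFlip sampling σ₀ v 3 large) is-half) ⟨
        fromℕ 2 * outcome tester p q v 4 (start tester δ ε)  ∎)

    module _ (1≰2δ : ¬ fromℕ 1 ≤ fromℕ 2 * δ) where
      private
        small : holds δ-large σ₀ ≡ false
        small = ⌊⌋-false (fromℕ 1 ≤? fromℕ 2 * δ) 1≰2δ

      guarantee-ε-large : fromℕ 2 ≤ x → Guarantee n δ ε
      guarantee-ε-large 2≤x = 3 , constant-time (ℕₚ.m≤m+n 3 _) ,
        branch-halts n δ-large coinFlip sampling σ₀ 2 small
          (branch-halts n ε-large skip repetition σ₀ 1 large tt) , λ p q →
          (λ _ → accepted p q) ,
          (λ ε<norm → contradiction (≤-trans (distance²≤2 p q) 2≤x) (far⇒ p q ε<norm))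
        where
        open ≤-Reasoning
        large : holds ε-large σ₀ ≡ true
        large = ⌊⌋-true (fromℕ 2 ≤? x) 2≤x

        accepted : ∀ p q → 1# - δ ≤ outcome tester p q true 3 (start tester δ ε)
        accepted p q = begin
          1# - δ  ≤⟨ ≤-by δ 0≤δ (solve 1 (λ d → num 1 := (num 1 :- d) :+ d) refl δ) ⟩
          1#      ≡⟨ ≡.trans
            (branch-outcome p q δ-large coinFlip sampling σ₀ true 2 small)
            (≡.trans (branch-outcome p q ε-large skip repetition σ₀ true 1 large)
              (≡.cong (verdict tester p q true) (⌊⌋-true (0# ≤? 0#) ≤-refl))) ⟨
          outcome tester p q true 3 (start tester δ ε)  ∎

      module _ (2≰x : ¬ fromℕ 2 ≤ x) where
        private
          small′ : holds ε-large σ₀ ≡ false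
          small′ = ⌊⌋-false (fromℕ 2 ≤? x) 2≰x

          x≤2 : x ≤ fromℕ 2
          x≤2 = ≰⇒≥ 2≰x

          0<r : 0# < m - x * x
          -- 836 = m - 4, and x² ≤ 4.
          0<r = <-≤-trans (fromℕ-pos 835) (≤-by ((fromℕ 2 - x) * (fromℕ 2 + x))
            (*-nonneg (difference-nonneg x≤2) (+-nonneg (fromℕ-nonneg 2) 0≤x))
            (solve 1 (λ x → num 840 :- x :* x :=
                num 836 :+ (num 2 :- x) :* (num 2 :+ x)) refl x))

          σ₁ : Store
          σ₁ = setᵣ 4 (fromℕ 1) (setᵣ 3 (fromℕ 1) (setᵣ 2 (fromℕ 1) σ₀))

        guarantee-repetition : ∀ N → Rounds δ (m - x * x) N (fromℕ 1) (fromℕ 1) →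
                 fromℕ (8 ℕ.+ loopTime N) ≤ fromℕ budget * (1# + g * ℓ) → Guarantee n δ ε
        guarantee-repetition N rounds in-time = 8 ℕ.+ loopTime N , in-time ,
          branch-halts n δ-large coinFlip sampling σ₀ (7 ℕ.+ loopTime N) small
            (branch-halts n ε-large skip repetition σ₀ (6 ℕ.+ loopTime N) small′
              (loop-halts n N σ₁ rounds)) ,
          λ p q →
            (λ close → correct p q true
              (close-potential p q 0≤x x≤2 (close⇒ p q close))
              (refl , fromℕ-nonneg 1)) ,
            (λ far → correct p q false
              (far-potential p q 0≤x x≤2 (≰⇒≥ (far⇒ p q far)))
              (fromℕ-pos 0 , fromℕ-nonneg 1 , ≤-refl))
          where
          open ≤-Reasoning
          correct : ∀ p q v (P : Potential p q v x) →
                    Potential.Inv P (fromℕ 1) (fromℕ 1) (fromℕ 1) →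
                    1# - δ ≤ outcome tester p q v (8 ℕ.+ loopTime N) (start tester δ ε)
          correct p q v P inv = +-cancelʳ-≤ δ (begin
            1# - δ + δ
              ≈⟨ solve 1 (λ d → (num 1 :- d) :+ d := num 1 :+ num 0) refl δ ⟩
            fromℕ 1
              ≤⟨ loop-correct p q 0≤δ 0<r P N σ₁ (fromℕ 1) ≡.refl ≡.refl rounds inv ⟩
            fromℕ 1 * O + δ * fromℕ 1
              ≈⟨ solve 2 (λ o d → (num 1 :+ num 0) :* o :+ d :* (num 1 :+ num 0) :=
                  o :+ d) refl O δ ⟩
            O + δ                  ≡⟨ ≡.cong (_+ δ) (≡.trans
              (branch-outcome p q δ-large coinFlip sampling σ₀ v (7 ℕ.+ loopTime N) small)
              (branch-outcome p q ε-large skip repetition σ₀ v (6 ℕ.+ loopTime N) small′)) ⟨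
            outcome tester p q v (8 ℕ.+ loopTime N) (start tester δ ε) + δ  ∎)
            where
            O : Carrier
            O = outcome tester p q v (loopTime N) (loop ∷ [] , σ₁)

        -- Here k + 1 is the least multiplier with (k + 1) x² > m, and L + 1 the least
        -- exponent with 2 ^ (L + 1) > 1 / δ.
        guarantee-ε-small : Guarantee n δ ε
        guarantee-ε-small =
          let k , ku≤m , k+1≰  = archimedes (*-pos 0<x 0<x) (fromℕ-nonneg scale)
              B , 2^B≰δ⁻¹      = exceeded-by-2^ (≤-trans 0≤1 1≤δ⁻¹)
              L , 2^L≤ , 2^L+1≰ = last-before (λ a → fromℕ 2 ^ a ≤? δ ⁻¹) 1≤δ⁻¹ B 2^B≰δ⁻¹
              N , N≤kL , rounds = few-rounds (proj₁ 0<r) 0<δ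
                                    (suc k) (≰⇒≥ k+1≰) (suc L) 2^L+1≰
          in guarantee-repetition N rounds (in-time N k L N≤kL ku≤m 2^L≤)
          where
          open ≤-Reasoning

          2≤δ⁻¹ : fromℕ 2 ^ 1 ≤ δ ⁻¹
          2≤δ⁻¹ = *-cancelˡ-≤ 0<δ (begin
            δ * (fromℕ 2 * 1#)  ≈⟨ solve 1 (λ d → d :* (num 2 :* num 1) := num 2 :* d) refl δ ⟩
            fromℕ 2 * δ         ≤⟨ ≰⇒≥ 1≰2δ ⟩
            fromℕ 1             ≈⟨ +-identityʳ 1# ⟩
            1#                  ≈⟨ *-inverseʳ δ (pos⇒≉0 0<δ) ⟨
            δ * δ ⁻¹            ∎)

          suc-L≤2ℓ : ∀ L → fromℕ 2 ^ L ≤ δ ⁻¹ → fromℕ (suc L) ≤ fromℕ 2 * ℓ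
          suc-L≤2ℓ L 2^L≤ = begin
            1# + fromℕ L
              ≤⟨ +-mono-≤ (≤-respˡ-≈ (+-identityʳ 1#) (fromℕ≤log₂ 1≤δ⁻¹ 1 2≤δ⁻¹))
                          (fromℕ≤log₂ 1≤δ⁻¹ L 2^L≤) ⟩
            ℓ + ℓ              ≈⟨ solve 1 (λ l → l :+ l := num 2 :* l) refl ℓ ⟩
            fromℕ 2 * ℓ        ∎

          x²g≈1 : (x * x) * g ≈ 1#
          x²g≈1 = trans
            (solve 2 (λ e i → (e :* e :* (e :* e)) :* (i :* (i :* (i :* (i :* num 1)))) :=
                (e :* i) :* (e :* i) :* ((e :* i) :* (e :* i))) refl ε (ε ⁻¹))
            (trans (*-cong (*-cong εi εi) (*-cong εi εi))
              (solve 0 (num 1 :* num 1 :* (num 1 :* num 1) := num 1) refl))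
            where
            εi : ε * ε ⁻¹ ≈ 1#
            εi = *-inverseʳ ε (pos⇒≉0 0<ε)

          suc-k≤844g : ∀ k → fromℕ k * (x * x) ≤ m → fromℕ (suc k) ≤ fromℕ 844 * g
          suc-k≤844g k kx²≤m = begin
            fromℕ (suc k)                    ≈⟨ trans (*-congˡ x²g≈1) (*-identityʳ _) ⟨
            fromℕ (suc k) * ((x * x) * g)
              ≈⟨ solve 3 (λ k y g → (num 1 :+ k) :* (y :* g) :=
                  g :* (k :* y :+ y)) refl (fromℕ k) (x * x) g ⟩
            g * (fromℕ k * (x * x) + x * x)
              ≤⟨ *-monoˡ-≤ 0≤g (+-mono-≤ kx²≤m (*-mono-≤ 0≤x (fromℕ-nonneg 2) x≤2 x≤2)) ⟩
            g * (m + fromℕ 2 * fromℕ 2)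
              ≈⟨ solve 1 (λ g → g :* (num 840 :+ num 2 :* num 2) := num 844 :* g) refl g ⟩
            fromℕ 844 * g                    ∎

          in-time : ∀ N k L → N ℕ.≤ suc k ℕ.* suc L → fromℕ k * (x * x) ≤ m → fromℕ 2 ^ L ≤ δ ⁻¹ →
                    fromℕ (8 ℕ.+ loopTime N) ≤ fromℕ budget * (1# + g * ℓ)
          in-time N k L N≤kL kx²≤m 2^L≤ = begin
            fromℕ (8 ℕ.+ loopTime N)
              ≡⟨ ≡.cong fromℕ (≡.trans (ℕₚ.+-suc 8 (N ℕ.* 14)) (≡.cong (9 ℕ.+_) (ℕₚ.*-comm N 14))) ⟩
            fromℕ (9 ℕ.+ 14 ℕ.* N)
              ≈⟨ trans (fromℕ-+ 9 (14 ℕ.* N)) (+-congˡ (fromℕ-* 14 N)) ⟩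
            fromℕ 9 + fromℕ 14 * fromℕ N
              ≤⟨ +-mono-≤ ≤-refl (*-monoˡ-≤ (fromℕ-nonneg 14) N≤) ⟩
            fromℕ 9 + fromℕ 14 * ((fromℕ 844 * g) * (fromℕ 2 * ℓ))
              ≤⟨ ≤-by (fromℕ 9 * (g * ℓ) + fromℕ 14 * (fromℕ 2 * fromℕ 844))
                   (+-nonneg (*-nonneg (fromℕ-nonneg 9) 0≤gℓ)
                     (*-nonneg (fromℕ-nonneg 14) (*-nonneg (fromℕ-nonneg 2) (fromℕ-nonneg 844))))
                   (solve 6 (λ a b c d g l → (a :+ b :* (c :* d)) :* (num 1 :+ g :* l) :=
                      (a :+ b :* ((d :* g) :* (c :* l))) :+ (a :* (g :* l) :+ b :* (c :* d))) refl
                      (fromℕ 9) (fromℕ 14) (fromℕ 2) (fromℕ 844) g ℓ) ⟩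
            (fromℕ 9 + fromℕ 14 * (fromℕ 2 * fromℕ 844)) * (1# + g * ℓ)
              ≈⟨ *-congʳ (trans (fromℕ-+ 9 (14 ℕ.* (2 ℕ.* 844))) (+-congˡ
                   (trans (fromℕ-* 14 (2 ℕ.* 844)) (*-congˡ (fromℕ-* 2 844))))) ⟨
            fromℕ budget * (1# + g * ℓ)          ∎
            where
            N≤ : fromℕ N ≤ (fromℕ 844 * g) * (fromℕ 2 * ℓ)
            N≤ = begin
              fromℕ N                        ≤⟨ fromℕ-mono N≤kL ⟩
              fromℕ (suc k ℕ.* suc L)        ≈⟨ fromℕ-* (suc k) (suc L) ⟩
              fromℕ (suc k) * fromℕ (suc L)
                ≤⟨ *-mono-≤ (fromℕ-nonneg (suc k)) (*-nonneg (fromℕ-nonneg 2) 0≤ℓ)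
                              (suc-k≤844g k kx²≤m) (suc-L≤2ℓ L 2^L≤) ⟩
              (fromℕ 844 * g) * (fromℕ 2 * ℓ)  ∎

    guarantee : Guarantee n δ ε
    guarantee = by-cases (fromℕ 1 ≤? fromℕ 2 * δ) (fromℕ 2 ≤? x)
      where
      by-cases : Dec (fromℕ 1 ≤ fromℕ 2 * δ) → Dec (fromℕ 2 ≤ x) → Guarantee n δ ε
      by-cases (yes 1≤2δ) _         = guarantee-δ-large 1≤2δ
      by-cases (no  1≰2δ) (yes 2≤x) = guarantee-ε-large 1≰2δ 2≤x
      by-cases (no  1≰2δ) (no  2≰x) = guarantee-ε-small 1≰2δ 2≰x

theorem2 : (ℝ : RealNumbers) → let open RealNumbers ℝ in let open Execution ℝ in
    Σ[ T ∈ Test ] Σ[ C ∈ ℕ ]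
    ((n : ℕ) (δ ε : Carrier) → 0# < δ → δ < 1# → 0# < ε →
    Σ[ t ∈ ℕ ]
    (fromℕ t ≤ fromℕ C * (1# + (ε ⁻¹) ^ 4 * log₂ (δ ⁻¹)) ×
    HaltsWithin n t (start T δ ε) ×
    ((p q : Distribution n) →
    (‖ prob p ⊝ prob q ‖₂ ≤ ε / fromℕ 2 →
    1# - δ ≤ Pr-accepts T δ ε t p q) ×
    (ε < ‖ prob p ⊝ prob q ‖₂ →
    1# - δ ≤ Pr-rejects T δ ε t p q))))
theorem2 ℝ = tester , Analysis.budget ℝ , λ n δ ε 0<δ δ<1 0<ε →
  Analysis.guarantee ℝ n 0<δ δ<1 0<ε
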